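{- Let $\mathcal{O}$ be a Euclidean oriented matroid on the ground set $E$, and let $\mathcal{O}\cup p=\mathcal{O}[e_1^{\alpha_1},\dots,e_k^{\alpha_k}]$ be a lexicographic extension of $\mathcal{O}$ in which $p$ is not a loop. Let $f\in E$ be an element that is not a coloop of $\mathcal{O}\cup p$. Then the oriented matroid program $(\mathcal{O}\cup p,p,f)$ is Euclidean.
   Context: Let $\mathcal{O}$ be an oriented matroid of rank $r$ on a finite ground set $E$, given by its set of cocircuits (sign vectors in $\{+,-,0\}^E$). For sign vectors $X,Y$: $\operatorname{supp}(X)=\{e:X_e\neq 0\}$, $z(X)=E\setminus\operatorname{supp}(X)$, $\operatorname{sep}(X,Y)=\{e: X_e=-Y_e\neq 0\}$, $(X\circ Y)_e=X_e$ if $X_e\neq 0$ and $(X\circ Y)_e=Y_e$ otherwise; $X,Y$ are conformal if $\operatorname{sep}(X,Y)=\emptyset$. $\mathcal{M}(\mathcal{O})$ is the underlying matroid. An edge is a covector $F$ whose zero set $z(F)$ is a flat of rank $r-2$ of $\mathcal{M}(\mathcal{O})$. Two cocircuits $X\neq\pm Y$ are comodular if $X\circ Y$ is an edge. For comodular cocircuits $X,Y$ and $e\in\operatorname{sep}(X,Y)$ there is a unique cocircuit $Z$ with $Z_e=0$ and $Z_h=(X\circ Y)_h$ for all $h\notin\operatorname{sep}(X,Y)$ ("cocircuit elimination of $e$ between $X$ and $Y$"). An oriented matroid program is a triple $(\mathcal{O},g,f)$ with $g\neq f\in E$, $g$ not a loop, $f$ not a coloop. For comodular cocircuits $X,Y$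 with $X_g=Y_g\neq 0$ let $Z$ be obtained by eliminating $g$ between $-X$ and $Y$; write $X\to_{g,f}Y$ if $Z_f=+$, $X\leftarrow_{g,f}Y$ if $Z_f=-$, and $X\leftrightarrow_{g,f}Y$ (undirected) if $Z_f=0$. The cocircuit graph $G_f$ of $(\mathcal{O},g,f)$ has as vertices the cocircuits $X$ with $X_g=+$ and as edges the pairs $\{X,Y\}$ of conformal comodular such cocircuits, oriented as just described. A directed cycle in $G_f$ is a sequence $P^1,\dots,P^n=P^1$ of vertices with $P^1,\dots,P^{n-1}$ pairwise distinct, $\{P^i,P^{i+1}\}$ an edge, $P^i\to P^{i+1}$ or $P^i\leftrightarrow P^{i+1}$ for all $i$, and $P^i\to P^{i+1}$ for at least one $i$. The program is Euclidean if $G_f$ has no directed cycle. An oriented matroid $\mathcal{O}$ is Euclidean if every oriented matroid program $(\mathcal{O},g,f)$ is Euclidean. A single-element extension $\mathcal{O}\cup p$ is determined by a localization $\sigma$ (a map from cocircuits of $\mathcal{O}$ to $\{+,-,0\}$); its cocircuits are the old cocircuits $(Y,\sigma(Y))$, $Y$ a cocircuit of $\mathcal{O}$, and the new cocircuits $(Y^1\circ Y^2,0)$ with $Y^1,Y^2$ conformal comodular cocircuits of $\mathcal{O}$ with $\sigma(Y^1)=-\sigma(Y^2)\neq 0$. For an ordered subset $I=[e_1,\dots,e_k]$ of $E$, the index of a cocircuit $Y$ with respect to $I$ is the smallest $i$ with $Y_{e_i}\neq 0$, or $k+1$ if there is none. For $\alpha\in\{+,-\}^k$, the lexicographic extension $\mathcal{O}[e_1^{\alpha_1},\dots,e_k^{\alpha_k}]=\mathcal{O}\cup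 p$ is the single-element extension with localization $\sigma(Y)=\alpha_iY_{e_i}$ if the index $i$ of $Y$ is $\le k$, and $\sigma(Y)=0$ otherwise. -}

module Defs where

open import Data.Fin.Base using (Fin; zero; suc; inject₁; fromℕ)
open import Data.Fin.Subset
  using (Subset; Side; inside; outside; _∈_; _∉_; _⊆_; _⊈_; _∪_; ∁; ⁅_⁆; ∣_∣; Empty; ⊤)
open import Data.Nat.Base using (ℕ; suc; _+_; _≤_; _<_)
open import Data.Product.Base using (_×_; ∃-syntax)
open import Data.Sign.Base using (Sign)
open import Data.Sum.Base using (_⊎_)
open import Data.Vec.Base using (Vec; []; _∷_; map; zipWith; lookup; replicate)
open import Function.Base using (_∘_)
open import Function.Bundles using (_⇔_)
open import Function.Definitions using (Injective)
open import Level using (0ℓ)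
open import Relation.Binary.PropositionalEquality.Core using (_≡_; _≢_)
open import Relation.Nullary.Negation.Core using (¬_)
open import Relation.Unary using (Pred; Decidable)

data Sign₀ : Set where
  ⊕ ⊖ 𝟎 : Sign₀

infix  8 ⊝_ -_
infixl 7 _·_
infixr 6 _▹_ _⊚_

⊝_ : Sign₀ → Sign₀
⊝ ⊕ = ⊖
⊝ ⊖ = ⊕
⊝ 𝟎 = 𝟎

_·_ : Sign → Sign₀ → Sign₀
Sign.+ · s = s
Sign.- · s = ⊝ s

_▹_ : Sign₀ → Sign₀ → Sign₀
⊕ ▹ t = ⊕
⊖ ▹ t = ⊖
𝟎 ▹ t = t

SignVector : ℕ → Set
SignVector n = Vec Sign₀ n

-_ : ∀ {n} → SignVector n → SignVector n
-_ = map ⊝_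

-- The composition usually written X ∘ Y; here _∘_ is function composition.
_⊚_ : ∀ {n} → SignVector n → SignVector n → SignVector n
_⊚_ = zipWith _▹_

side : Sign₀ → Side
side 𝟎 = outside
side ⊕ = inside
side ⊖ = inside

supp : ∀ {n} → SignVector n → Subset n
supp = map side

zeros : ∀ {n} → SignVector n → Subset n
zeros X = ∁ (supp X)

opposed : Sign₀ → Sign₀ → Side
opposed ⊕ ⊖ = inside
opposed ⊖ ⊕ = inside
opposed ⊕ ⊕ = outside
opposed ⊖ ⊖ = outside
opposed ⊕ 𝟎 = outside
opposed ⊖ 𝟎 = outside
opposed 𝟎 t = outside

sep : ∀ {n} → SignVector n → SignVector n → Subset n
sep = zipWith opposed

Conformal : ∀ {n} → SignVector n → SignVector n → Set
Conformal X Y = Empty (sep X Y)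

-- Oriented matroids on the ground set Fin n, by the (weak elimination)
-- cocircuit axioms.  The decidability field says only that the cocircuits
-- form a subset, in the classical sense, of the finite set of sign vectors.

record OrientedMatroid (n : ℕ) : Set₁ where
  field
    Cocircuit    : Pred (SignVector n) 0ℓ
    cocircuit?   : Decidable Cocircuit
    nonzero      : ¬ Cocircuit (replicate n 𝟎)
    symmetric    : ∀ {X} → Cocircuit X → Cocircuit (- X)
    incomparable : ∀ {X Y} → Cocircuit X → Cocircuit Y →
                   supp X ⊆ supp Y → X ≡ Y ⊎ X ≡ - Y
    elimination  : ∀ {X Y e} → Cocircuit X → Cocircuit Y → X ≢ - Y →
                   e ∈ sep X Y →
                   ∃[ Z ] Cocircuit Z × lookup Z e ≡ 𝟎 ×
                          (∀ h → lookup Z h ≢ 𝟎 →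
                             lookup Z h ≡ lookup X h ⊎ lookup Z h ≡ lookup Y h)

-- The underlying matroid: the matroid whose cocircuits are the supports of
-- the cocircuits of O.  The independent sets of its dual are the sets
-- containing no such support, and its bases are the complements of the
-- bases of its dual.

module _ {n : ℕ} (O : OrientedMatroid n) where
  open OrientedMatroid O

  Coindependent : Subset n → Set
  Coindependent S = ∀ {X} → Cocircuit X → supp X ⊈ S

  Cobasis : Subset n → Set
  Cobasis S = Coindependent S × (∀ {T} → Coindependent T → S ⊆ T → T ⊆ S)

  Basis : Subset n → Set
  Basis B = Cobasis (∁ B)

  Independent : Subset n → Set
  Independent I = ∃[ B ] Basis B × I ⊆ B

  IsLoop : Fin n → Set
  IsLoop e = ∀ {B} → Basis B → e ∉ B

  IsColoop : Fin n → Set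
  IsColoop e = ∀ {B} → Basis B → e ∈ B

  HasRank : Subset n → ℕ → Set
  HasRank A k = (∃[ I ] I ⊆ A × Independent I × ∣ I ∣ ≡ k) ×
                (∀ {I} → I ⊆ A → Independent I → ∣ I ∣ ≤ k)

  IsFlat : Subset n → Set
  IsFlat A = ∀ {e k l} → e ∉ A → HasRank A k → HasRank (A ∪ ⁅ e ⁆) l → k < l

  data Covector : SignVector n → Set where
    zero-covector : Covector (replicate n 𝟎)
    compose       : ∀ {X F} → Cocircuit X → Covector F → Covector (X ⊚ F)

  -- The rank of O is r = 2 + k.
  IsEdge : SignVector n → Set
  IsEdge F = Covector F × IsFlat (zeros F) ×
             (∃[ k ] HasRank ⊤ (2 + k) × HasRank (zeros F) k)

  Comodular : SignVector n → SignVector n → Set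
  Comodular X Y = Cocircuit X × Cocircuit Y × X ≢ Y × X ≢ - Y × IsEdge (X ⊚ Y)

  -- Z is the result of cocircuit elimination of e between X and Y; for
  -- comodular X, Y and e ∈ sep X Y there is exactly one such Z.
  Eliminates : SignVector n → SignVector n → Fin n → SignVector n → Set
  Eliminates X Y e Z = Cocircuit Z × lookup Z e ≡ 𝟎 ×
                       (∀ h → h ∉ sep X Y → lookup Z h ≡ lookup (X ⊚ Y) h)

record Program {n : ℕ} (O : OrientedMatroid n) : Set where
  constructor program
  field
    g           : Fin n
    f           : Fin n
    g≢f         : g ≢ f
    g-nonloop   : ¬ IsLoop O g
    f-noncoloop : ¬ IsColoop O f

module _ {n : ℕ} {O : OrientedMatroid n} (P : Program O) where
  open OrientedMatroid O
  open Program P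

  Vertex : SignVector n → Set
  Vertex X = Cocircuit X × lookup X g ≡ ⊕

  Adjacent : SignVector n → SignVector n → Set
  Adjacent X Y = Vertex X × Vertex Y × Conformal X Y × Comodular O X Y

  -- The Z of the elimination is unique when X and Y are adjacent: s = ⊕ is
  -- X → Y, s = ⊖ is X ← Y and s = 𝟎 is the undirected case.
  Oriented : Sign₀ → SignVector n → SignVector n → Set
  Oriented s X Y = ∃[ Z ] Eliminates O (- X) Y g Z × lookup Z f ≡ s

  infix 4 _⟶_ _⟷_

  _⟶_ : SignVector n → SignVector n → Set
  X ⟶ Y = Adjacent X Y × Oriented ⊕ X Y

  _⟷_ : SignVector n → SignVector n → Set
  X ⟷ Y = Adjacent X Y × Oriented 𝟎 X Y

  -- The sequence P¹ , … , Pⁿ with n = suc m.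
  record DirectedCycle : Set where
    field
      {m}      : ℕ
      vertex   : Fin (suc m) → SignVector n
      closed   : vertex (fromℕ m) ≡ vertex zero
      distinct : Injective _≡_ _≡_ (vertex ∘ inject₁)
      step     : ∀ i → vertex (inject₁ i) ⟶ vertex (suc i) ⊎
                       vertex (inject₁ i) ⟷ vertex (suc i)
      directed : ∃[ i ] vertex (inject₁ i) ⟶ vertex (suc i)

  EuclideanProgram : Set
  EuclideanProgram = ¬ DirectedCycle

Euclidean : ∀ {n} → OrientedMatroid n → Set
Euclidean O = (P : Program O) → EuclideanProgram P

-- On the ground set Fin (suc n) of O ∪ p the
-- new element p is zero and e : Fin n becomes suc e.

-- The map σ is defined on all sign vectors, but only its values on
-- cocircuits of O matter.
data ExtensionCocircuit {n : ℕ} (O : OrientedMatroid n)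
                        (σ : SignVector n → Sign₀) : SignVector (suc n) → Set where
  old : ∀ {Y} → OrientedMatroid.Cocircuit O Y → ExtensionCocircuit O σ (σ Y ∷ Y)
  new : ∀ {Y¹ Y²} → Conformal Y¹ Y² → Comodular O Y¹ Y² →
        σ Y¹ ≡ ⊝ σ Y² → σ Y¹ ≢ 𝟎 → ExtensionCocircuit O σ (𝟎 ∷ (Y¹ ⊚ Y²))

IsExtension : ∀ {n} → OrientedMatroid n → (SignVector n → Sign₀) →
              OrientedMatroid (suc n) → Set
IsExtension O σ O∪p =
  ∀ Z → OrientedMatroid.Cocircuit O∪p Z ⇔ ExtensionCocircuit O σ Z

-- The first nonzero sign among α₁ Y_{e₁} , … , α_k Y_{e_k}, or 𝟎 if there
-- is none.
lexicographic : ∀ {n k} → Vec (Fin n) k → Vec Sign k → SignVector n → Sign₀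
lexicographic []      []      Y = 𝟎
lexicographic (e ∷ I) (a ∷ α) Y = a · lookup Y e ▹ lexicographic I α Y

IsLexicographicExtension : ∀ {n k} → OrientedMatroid n → Vec (Fin n) k →
                           Vec Sign k → OrientedMatroid (suc n) → Set
IsLexicographicExtension O I α = IsExtension O (lexicographic I α)

{-# OPTIONS --safe #-}
module Submission where

-- Cut the lines X ∘ Y of O, that is, its edges, by p.  If e is the first element of I that does
-- not vanish on a line, p meets the line at the cocircuit Z of e when σ(Z) = 0, and otherwise
-- infinitesimally close to Z.  Along a directed cycle of (O ∪ p , p , f) the sign of f can only
-- grow, so it is constant, and it is nonzero.  If the first e of I that does not vanish on the
-- whole cycle vanished at some but not all of the vertices, the cycle would both enter and leave
-- the hyperplane of e, and the constant sign of f allows only one of these.  So all vertices lie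
-- on the same side of e and the cycle is a closed walk in (O , e , f), whose orientations agree
-- with those in (O ∪ p , p , f) except that some become undirected.  As O is Euclidean, f vanishes
-- at every Z, so f and e are parallel or antiparallel on each line and the orientations in
-- (O ∪ p , p , f) are read off from σ(Z).  Hence each σ(Z) is 0 or one fixed sign, and Euclideanness
-- of (O , e , e′) for the successive further elements e′ of I forces σ(Z) = 0 everywhere, so that
-- no step is directed.

open import Defs
open import Data.Empty using (⊥; ⊥-elim)
open import Data.Fin.Base using (Fin; zero; suc; inject₁; fromℕ; opposite)
open import Data.Fin.Properties using (any?; all?; _≟_; opposite-involutive; ¬∀⟶∃¬; 0≢1+n)
open import Data.Fin.Relation.Unary.Top using (view; ‵fromℕ; ‵inject₁)
open import Data.Fin.Subset renaming (⊥ to ∅) hiding (_-_)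
open import Data.Fin.Subset.Properties
open import Data.Nat.Base using (ℕ; zero; suc; _+_; _≤_; _<_; z≤n; s≤s)
import Data.Nat.Properties as ℕ
open import Data.Product.Base using (_×_; _,_; ∃-syntax; proj₁; proj₂)
open import Data.Sign.Base using (Sign)
open import Data.Sum.Base using (_⊎_; inj₁; inj₂; [_,_]′)
import Data.Sum.Base as Sum
open import Data.Vec.Base as Vec using (Vec; []; _∷_; lookup; replicate; here; there)
open import Data.Vec.Properties
  using (lookup-map; lookup-zipWith; lookup-replicate; lookup⇒[]=; []=⇒lookup;
         tabulate∘lookup; tabulate-cong; ≡-dec)
open import Data.Vec.Relation.Unary.Unique.Propositional using (Unique)
open import Function.Base using (_∘_)
open import Function.Bundles using (module Equivalence)
open import Function.Definitions using (Injective)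
open import Level using (0ℓ)
open import Relation.Binary.Definitions using (DecidableEquality)
open import Relation.Binary.PropositionalEquality
  using (_≡_; _≢_; refl; sym; trans; cong; cong₂; subst)
open import Relation.Nullary.Decidable
  using (Dec; yes; no; _×-dec_; _⊎-dec_; ¬?; map′; decidable-stable)
open import Relation.Nullary.Negation.Core using (¬_)
open import Relation.Unary using (Pred; Decidable)

private variable
  n : ℕ
  s t : Sign₀
  e f h : Fin n
  X Y Z U V D : SignVector n

-- Signs and sign vectors

infix 4 _≟₀_ _≟ᵥ_ _≡±_ _≡±?_

_≟₀_ : DecidableEquality Sign₀
⊕ ≟₀ ⊕ = yes refl
⊕ ≟₀ ⊖ = no λ ()
⊕ ≟₀ 𝟎 = no λ ()
⊖ ≟₀ ⊕ = no λ ()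
⊖ ≟₀ ⊖ = yes refl
⊖ ≟₀ 𝟎 = no λ ()
𝟎 ≟₀ ⊕ = no λ ()
𝟎 ≟₀ ⊖ = no λ ()
𝟎 ≟₀ 𝟎 = yes refl

⊝-involutive : ∀ s → ⊝ ⊝ s ≡ s
⊝-involutive ⊕ = refl
⊝-involutive ⊖ = refl
⊝-involutive 𝟎 = refl

⊝-zero⁻ : ⊝ s ≡ 𝟎 → s ≡ 𝟎
⊝-zero⁻ {𝟎} _ = refl

fixed⇒zero : s ≡ ⊝ s → s ≡ 𝟎
fixed⇒zero {𝟎} _ = refl

nonzero-signs : s ≢ 𝟎 → t ≢ 𝟎 → s ≡ t ⊎ s ≡ ⊝ t
nonzero-signs {⊕} {⊕} _ _ = inj₁ refl
nonzero-signs {⊕} {⊖} _ _ = inj₂ refl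
nonzero-signs {⊖} {⊕} _ _ = inj₂ refl
nonzero-signs {⊖} {⊖} _ _ = inj₁ refl
nonzero-signs {𝟎}     a _ = ⊥-elim (a refl)
nonzero-signs {t = 𝟎} _ b = ⊥-elim (b refl)

▹-nonzero : s ≢ 𝟎 → s ▹ t ≡ s
▹-nonzero {⊕} _ = refl
▹-nonzero {⊖} _ = refl
▹-nonzero {𝟎} a = ⊥-elim (a refl)

▹-zero⁻ : s ▹ t ≡ 𝟎 → s ≡ 𝟎 × t ≡ 𝟎
▹-zero⁻ {𝟎} p = refl , p

_≟ᵥ_ : DecidableEquality (SignVector n)
_≟ᵥ_ = ≡-dec _≟₀_

lookup-ext : (∀ h → lookup X h ≡ lookup Y h) → X ≡ Y
lookup-ext {X = X} {Y} p =
  trans (sym (tabulate∘lookup X)) (trans (tabulate-cong p) (tabulate∘lookup Y))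

lookup-neg : ∀ (X : SignVector n) h → lookup (- X) h ≡ ⊝ lookup X h
lookup-neg X h = lookup-map h ⊝_ X

lookup-⊚ : ∀ (X Y : SignVector n) h → lookup (X ⊚ Y) h ≡ lookup X h ▹ lookup Y h
lookup-⊚ X Y h = lookup-zipWith _▹_ h X Y

neg-involutive : ∀ (X : SignVector n) → - - X ≡ X
neg-involutive []      = refl
neg-involutive (x ∷ X) = cong₂ _∷_ (⊝-involutive x) (neg-involutive X)

neg-zero : lookup X h ≡ 𝟎 → lookup (- X) h ≡ 𝟎
neg-zero {X = X} {h} p = trans (lookup-neg X h) (cong ⊝_ p)

∈supp⁺ : lookup X e ≢ 𝟎 → e ∈ supp X
∈supp⁺ {X = X} {e} p = lookup⇒[]= e (supp X) (trans (lookup-map e side X) (nz p))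
  where
  nz : s ≢ 𝟎 → side s ≡ inside
  nz {⊕} _ = refl
  nz {⊖} _ = refl
  nz {𝟎} a = ⊥-elim (a refl)

∈supp⁻ : e ∈ supp X → lookup X e ≢ 𝟎
∈supp⁻ {e = e} {X} p q
  with () ← trans (sym ([]=⇒lookup p)) (trans (lookup-map e side X) (cong side q))

∈zeros⁻ : e ∈ zeros X → lookup X e ≡ 𝟎
∈zeros⁻ p = decidable-stable (_ ≟₀ _) (x∈∁p⇒x∉p p ∘ ∈supp⁺)

∈sep⁺ : lookup X e ≡ ⊝ lookup Y e → lookup X e ≢ 𝟎 → e ∈ sep X Y
∈sep⁺ {X = X} {e} {Y} p q =
  lookup⇒[]= e (sep X Y) (trans (lookup-zipWith opposed e X Y) (opp p q))
  where
  opp : s ≡ ⊝ t → s ≢ 𝟎 → opposed s t ≡ inside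
  opp {⊕} {⊖} _ _ = refl
  opp {⊖} {⊕} _ _ = refl
  opp {𝟎}     _ b = ⊥-elim (b refl)

∈sep⁻ : e ∈ sep X Y → lookup X e ≡ ⊝ lookup Y e × lookup X e ≢ 𝟎
∈sep⁻ {e = e} {X} {Y} p = opp (trans (sym (lookup-zipWith opposed e X Y)) ([]=⇒lookup p))
  where
  opp : opposed s t ≡ inside → s ≡ ⊝ t × s ≢ 𝟎
  opp {⊕} {⊖} _ = refl , λ ()
  opp {⊖} {⊕} _ = refl , λ ()

∁-involutive : ∀ (S : Subset n) → ∁ (∁ S) ≡ S
∁-involutive S = ⊆-antisym (λ p → x∉∁p⇒x∈p (x∈∁p⇒x∉p p)) (λ p → x∉p⇒x∈∁p (x∈p⇒x∉∁p p))

_≡±_ : SignVector n → SignVector n → Set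
X ≡± Y = X ≡ Y ⊎ X ≡ - Y

_≡±?_ : ∀ (X Y : SignVector n) → Dec (X ≡± Y)
X ≡±? Y = X ≟ᵥ Y ⊎-dec X ≟ᵥ - Y

≡±-sym : X ≡± Y → Y ≡± X
≡±-sym (inj₁ refl)             = inj₁ refl
≡±-sym {Y = Y} (inj₂ refl) = inj₂ (sym (neg-involutive Y))

≡±-zero : X ≡± Y → lookup Y h ≡ 𝟎 → lookup X h ≡ 𝟎
≡±-zero             (inj₁ refl) p = p
≡±-zero {Y = Y} {h} (inj₂ refl) p = neg-zero {X = Y} {h} p

any-vector? : ∀ {n} {P : Pred (SignVector n) 0ℓ} → Decidable P → Dec (∃[ X ] P X)
any-vector? {zero}  P? = map′ ([] ,_) (λ { ([] , p) → p }) (P? [])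
any-vector? {suc n} {P} P? =
  map′ (λ { (inj₁ (X , p)) → ⊕ ∷ X , p
          ; (inj₂ (inj₁ (X , p))) → ⊖ ∷ X , p
          ; (inj₂ (inj₂ (X , p))) → 𝟎 ∷ X , p })
       (λ { (⊕ ∷ X , p) → inj₁ (X , p)
          ; (⊖ ∷ X , p) → inj₂ (inj₁ (X , p))
          ; (𝟎 ∷ X , p) → inj₂ (inj₂ (X , p)) })
       (any-vector? (P? ∘ (⊕ ∷_)) ⊎-dec any-vector? (P? ∘ (⊖ ∷_)) ⊎-dec any-vector? (P? ∘ (𝟎 ∷_)))

-- Finite subsets and cardinalities

x∉p-x : ∀ (S : Subset n) {x} → x ∉ S ─ ⁅ x ⁆
-- Removing `x` a second time changes nothing, yet it would lower the cardinality.
x∉p-x S {x} u = ℕ.<-irrefl refl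
  (ℕ.<-≤-trans (x∈p⇒∣p-x∣<∣p∣ u) (ℕ.≤-reflexive (cong ∣_∣ (sym (p─q─q≡p─q S ⁅ x ⁆)))))

two-missing : ∀ {J B : Subset n} {x y} → J ⊆ B → x ∈ B → x ∉ J → y ∈ B → y ∉ J → x ≢ y →
              2 + ∣ J ∣ ≤ ∣ B ∣
two-missing {J = J} {B} {x} {y} J⊆B x∈B x∉J y∈B y∉J x≢y =
  ℕ.≤-trans (s≤s (p⊂q⇒∣p∣<∣q∣ J⊂)) (p⊂q⇒∣p∣<∣q∣ ⊂B)
  where
  J⊂ : J ⊂ J ∪ ⁅ x ⁆
  J⊂ = p⊆p∪q ⁅ x ⁆ , x , q⊆p∪q J ⁅ x ⁆ (x∈⁅x⁆ x) , x∉J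
  ⊂B : J ∪ ⁅ x ⁆ ⊂ B
  ⊂B = (λ p → [ J⊆B , (λ q → subst (_∈ B) (sym (x∈⁅y⁆⇒x≡y x q)) x∈B) ]′ (x∈p∪q⁻ J ⁅ x ⁆ p))
     , y , y∈B
     , λ p → [ y∉J , (λ q → x≢y (sym (x∈⁅y⁆⇒x≡y x q))) ]′ (x∈p∪q⁻ J ⁅ x ⁆ p)

-- Doubly negated because membership in P need not be decidable.
maximal : ∀ {P : Pred (Subset n) 0ℓ} {S} → P S →
          ¬ ¬ (∃[ T ] P T × (∀ {T′} → P T′ → ∣ T′ ∣ ≤ ∣ T ∣))
maximal {n} {P} {S} p none = climb n p (ℕ.m≤n⇒m≤o+n ∣ S ∣ ℕ.≤-refl)
  where
  -- The fuel `d` bounds how often the size can still grow, as no subset has more than `n` elements.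
  climb : ∀ d {T} → P T → n ≤ ∣ T ∣ + d → ⊥
  climb d {T} pT le = none (T , pT , λ {T′} pT′ → ℕ.≮⇒≥ λ lt → next d pT′ lt le)
    where
    next : ∀ d {T′} → P T′ → ∣ T ∣ < ∣ T′ ∣ → n ≤ ∣ T ∣ + d → ⊥
    next zero {T′} _ lt le =
      ℕ.<⇒≱ (ℕ.<-≤-trans lt (∣p∣≤n T′)) (subst (n ≤_) (ℕ.+-identityʳ _) le)
    next (suc d) pT′ lt le = climb d pT′
      (ℕ.≤-trans le (ℕ.≤-trans (ℕ.≤-reflexive (ℕ.+-suc _ d)) (ℕ.+-monoˡ-≤ d lt)))

-- The underlying matroid

module _ (O : OrientedMatroid n) where
  open OrientedMatroid O

  -- Elimination in the underlying matroid: when the signs at `e` agree, `- Y` replaces `Y`, which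
  -- has the same zeros.
  support-elimination : Cocircuit X → Cocircuit Y → ¬ X ≡± Y → lookup X e ≢ 𝟎 → lookup Y e ≢ 𝟎 →
    ∃[ Z ] Cocircuit Z × lookup Z e ≡ 𝟎 × (∀ h → lookup X h ≡ 𝟎 → lookup Y h ≡ 𝟎 → lookup Z h ≡ 𝟎)
  support-elimination {X = X} {Y} {e} cX cY X≢±Y x y with nonzero-signs x y
  ... | inj₂ opp
    with Z , cZ , Ze , Zh ← elimination cX cY (X≢±Y ∘ inj₂) (∈sep⁺ opp x) =
    Z , cZ , Ze , λ h p q → decidable-stable (_ ≟₀ _) λ r →
      r ([ (λ u → trans u p) , (λ u → trans u q) ]′ (Zh h r))
  ... | inj₁ same
    with Z , cZ , Ze , Zh ← elimination cX (symmetric cY)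
           (λ u → X≢±Y (inj₁ (trans u (neg-involutive Y))))
           (∈sep⁺ (trans same (trans (sym (⊝-involutive _)) (cong ⊝_ (sym (lookup-neg Y e))))) x) =
    Z , cZ , Ze , λ h p q → decidable-stable (_ ≟₀ _) λ r →
      r ([ (λ u → trans u p) , (λ u → trans u (neg-zero {X = Y} q)) ]′ (Zh h r))

  escape : Cocircuit X → Cocircuit Y → ¬ X ≡± Y → ∃[ h ] lookup X h ≢ 𝟎 × lookup Y h ≡ 𝟎
  escape {X = X} {Y} cX cY X≢±Y
    with any? (λ h → ¬? (lookup X h ≟₀ 𝟎) ×-dec (lookup Y h ≟₀ 𝟎))
  ... | yes found = found
  ... | no none   = ⊥-elim (X≢±Y (incomparable cX cY λ {h} p →
    ∈supp⁺ λ q → none (h , ∈supp⁻ p , q)))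

  dependent : ∀ {S} → ¬ Coindependent O S → ∃[ X ] Cocircuit X × supp X ⊆ S
  dependent {S} dep with any-vector? (λ X → cocircuit? X ×-dec (supp X ⊆? S))
  ... | yes found = found
  ... | no none   = ⊥-elim (dep λ c sub → none (_ , c , sub))

  -- `D` is the fundamental cocircuit of `x` with respect to the cobasis `S`.
  enlarge : ∀ {S x} → Cobasis O S → x ∉ S →
            ∃[ D ] Cocircuit D × (∀ {y} → lookup D y ≢ 𝟎 → y ∈ S ⊎ y ≡ x)
  enlarge {S} {x} (_ , max) x∉S
    with D , cD , sub ← dependent (λ ind → x∉S
           (max {S ∪ ⁅ x ⁆} ind (p⊆p∪q _) (q⊆p∪q S _ (x∈⁅x⁆ x)))) =
    D , cD , λ {y} p → [ inj₁ , (λ q → inj₂ (x∈⁅y⁆⇒x≡y x q)) ]′ (x∈p∪q⁻ S _ (sub (∈supp⁺ p)))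

  -- Basis exchange in the dual. The element `d` is taken from the fundamental cocircuit `D` of `p`,
  -- which has an element besides `p` because no cocircuit is supported on `p` alone.
  exchange : ∀ {S p} → Cobasis O S → p ∉ S → Coindependent O ⁅ p ⁆ →
             ∃[ d ] d ∈ S × Cobasis O ((S ─ ⁅ d ⁆) ∪ ⁅ p ⁆)
  exchange {S} {p} cob@(coind , _) p∉S indp
    with D , cD , subD ← enlarge cob p∉S
    with any? (λ d → ¬? (lookup D d ≟₀ 𝟎) ×-dec ¬? (d ≟ p))
  ... | no none = ⊥-elim (indp cD λ {x} q → subst (_∈ ⁅ p ⁆)
          (sym (decidable-stable (x ≟ p) λ r → none (x , ∈supp⁻ q , r))) (x∈⁅x⁆ p))
  ... | yes (d , Dd , d≢p) = d , d∈S , coind′ , max′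
    where
    S′ = (S ─ ⁅ d ⁆) ∪ ⁅ p ⁆
    d∈S : d ∈ S
    d∈S = [ (λ q → q) , (λ q → ⊥-elim (d≢p q)) ]′ (subD Dd)
    Dp : lookup D p ≢ 𝟎
    Dp q = coind cD λ {x} r → [ (λ u → u) , (λ { refl → ⊥-elim (∈supp⁻ r q) }) ]′ (subD (∈supp⁻ r))
    kept : ∀ {x} → x ∈ S → x ≢ d → x ∈ S′
    kept x∈S x≢d = p⊆p∪q _ (x∈p∧x≢y⇒x∈p-y x∈S x≢d)
    p∈S′ : p ∈ S′
    p∈S′ = q⊆p∪q _ _ (x∈⁅x⁆ p)
    from : ∀ {x} → x ∈ S′ → (x ∈ S × x ≢ d) ⊎ x ≡ p
    from {x} q with x∈p∪q⁻ (S ─ ⁅ d ⁆) _ q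
    ... | inj₂ r = inj₂ (x∈⁅y⁆⇒x≡y p r)
    ... | inj₁ r = inj₁ (p─q⊆p S ⁅ d ⁆ r , λ { refl → x∉p-x S r })
    misses-d : ∀ {E} → supp E ⊆ S′ → lookup E d ≡ 𝟎
    misses-d sub = decidable-stable (_ ≟₀ _) λ q →
      [ (λ r → proj₂ r refl) , d≢p ]′ (from (sub (∈supp⁺ q)))
    coind′ : Coindependent O S′
    coind′ {E} cE sub
      with lookup E p ≟₀ 𝟎
    ... | yes Ep = coind cE λ {x} q →
            [ proj₁ , (λ { refl → ⊥-elim (∈supp⁻ q Ep) }) ]′ (from (sub q))
    ... | no Ep
      -- Eliminating `p` against `D` moves a cocircuit inside `S′` back into `S`.
      with Z , cZ , Zp , Zh ← support-elimination cE cD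
             (λ E±D → Dd (≡±-zero (≡±-sym E±D) (misses-d sub))) Ep Dp
      = coind cZ λ {x} q → decidable-stable (x ∈? S) λ x∉S → ∈supp⁻ q (case x x∉S)
      where
      case : ∀ x → x ∉ S → lookup Z x ≡ 𝟎
      case x x∉S with x ≟ p
      ... | yes refl = Zp
      ... | no x≢p   = Zh x
        (decidable-stable (_ ≟₀ _) λ q → [ (λ r → x∉S (proj₁ r)) , x≢p ]′ (from (sub (∈supp⁺ q))))
        (decidable-stable (_ ≟₀ _) λ q → [ x∉S , x≢p ]′ (subD q))
    max′ : ∀ {T} → Coindependent O T → S′ ⊆ T → T ⊆ S′
    max′ {T} indT S′⊆T {t} t∈T = decidable-stable (t ∈? S′) go
      where
      go : ¬ t ∉ S′
      go t∉S′ with t ≟ d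
      ... | yes refl = indT cD λ {x} q → [ S⊆T , (λ { refl → S′⊆T p∈S′ }) ]′ (subD (∈supp⁻ q))
        where
        S⊆T : S ⊆ T
        S⊆T {x} x∈S with x ≟ t
        ... | yes refl = t∈T
        ... | no x≢t   = S′⊆T (kept x∈S x≢t)
      ... | no t≢d
        with E , cE , subE ← enlarge cob (λ t∈S → t∉S′ (kept t∈S t≢d))
        with lookup E d ≟₀ 𝟎
      ... | yes Ed = indT cE λ {x} q → inT (λ { refl → ∈supp⁻ q Ed }) (subE (∈supp⁻ q))
        where
        inT : ∀ {x} → x ≢ d → x ∈ S ⊎ x ≡ t → x ∈ T
        inT x≢d (inj₁ x∈S)  = S′⊆T (kept x∈S x≢d)
        inT x≢d (inj₂ refl) = t∈T
      -- Eliminating `d` between the fundamental cocircuits of `t` and `p` leaves a cocircuit inside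
      -- `T`.
      ... | no Ed
        with Z , cZ , Zd , Zh ← support-elimination cE cD (λ E±D → Dp (≡±-zero (≡±-sym E±D)
               (decidable-stable (_ ≟₀ _) λ q → [ p∉S , (λ { refl → t∉S′ p∈S′ }) ]′ (subE q)))) Ed Dd
        = indT cZ λ {x} q → decidable-stable (x ∈? T) λ x∉T → ∈supp⁻ q (outside-T x x∉T)
        where
        outside-T : ∀ x → x ∉ T → lookup Z x ≡ 𝟎
        outside-T x x∉T with x ≟ d
        ... | yes refl = Zd
        ... | no x≢d   = Zh x
          (decidable-stable (_ ≟₀ _) λ q →
            [ (λ x∈S → x∉T (S′⊆T (kept x∈S x≢d))) , (λ { refl → x∉T t∈T }) ]′ (subE q))
          (decidable-stable (_ ≟₀ _) λ q →
            [ (λ x∈S → x∉T (S′⊆T (kept x∈S x≢d))) , (λ { refl → x∉T (S′⊆T p∈S′) }) ]′ (subD q))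

  cobasis⇒basis : ∀ {S} → Cobasis O S → Basis O (∁ S)
  cobasis⇒basis {S} = subst (Cobasis O) (sym (∁-involutive S))

  cobasis-above : ∀ {S} → Coindependent O S → ¬ ¬ (∃[ T ] Cobasis O T × S ⊆ T)
  cobasis-above {S} indS none =
    maximal {P = λ T → Coindependent O T × S ⊆ T} (indS , λ p → p) λ (T , (indT , S⊆T) , max) →
      none (T , (indT , λ {T′} indT′ T⊆T′ {x} x∈T′ → decidable-stable (x ∈? T) λ x∉T →
        ℕ.<⇒≱ (p⊂q⇒∣p∣<∣q∣ (T⊆T′ , x , x∈T′ , x∉T)) (max (indT′ , λ p → T⊆T′ (S⊆T p)))) , S⊆T)

  -- By incomparability the support of `X` without `e` is coindependent. A cobasis above it misses
  -- `e`, since otherwise it would contain all of `supp X`; so the complementary basis contains `e`.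
  cocircuit⇒nonloop : Cocircuit X → lookup X e ≢ 𝟎 → ¬ IsLoop O e
  cocircuit⇒nonloop {X = X} {e} cX Xe loop =
    cobasis-above {S = supp X ─ ⁅ e ⁆} coind λ (T , cobT , sub) →
      loop (cobasis⇒basis cobT) (x∉p⇒x∈∁p λ e∈T → proj₁ cobT cX λ {x} x∈X →
        inT e∈T sub x x∈X)
    where
    inT : ∀ {T} → e ∈ T → supp X ─ ⁅ e ⁆ ⊆ T → ∀ x → x ∈ supp X → x ∈ T
    inT e∈T sub x x∈X with x ≟ e
    ... | yes refl = e∈T
    ... | no x≢e   = sub (x∈p∧x≢y⇒x∈p-y x∈X x≢e)
    coind : Coindependent O (supp X ─ ⁅ e ⁆)
    coind {Y} cY sub = ℕ.<⇒≱ (x∈p⇒∣p-x∣<∣p∣ (∈supp⁺ {X = X} Xe))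
      (p⊆q⇒∣p∣≤∣q∣ {p = supp X} λ {x} x∈X → sub (∈supp⁺ λ q → ∈supp⁻ {X = X} x∈X
        (≡±-zero (≡±-sym (incomparable cY cX (λ p → p─q⊆p (supp X) ⁅ e ⁆ (sub p)))) q)))

  OnLine : SignVector n → SignVector n → SignVector n → Set
  OnLine X Y U = Cocircuit U × (∀ h → lookup X h ≡ 𝟎 → lookup Y h ≡ 𝟎 → lookup U h ≡ 𝟎)

  -- The zero sets of the cocircuits on a line are hyperplanes that meet
  -- pairwise in the zero set of the line.
  Line : SignVector n → SignVector n → Set
  Line X Y = ∀ {U V h} → OnLine X Y U → OnLine X Y V → ¬ (lookup X h ≡ 𝟎 × lookup Y h ≡ 𝟎) →
             lookup U h ≡ 𝟎 → lookup V h ≡ 𝟎 → U ≡± V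

  cocircuit-meets-basis : ∀ {B} → Basis O B → Cocircuit X → ∃[ b ] b ∈ B × lookup X b ≢ 𝟎
  cocircuit-meets-basis {X} {B} (ind , _) cX with any? (λ b → (b ∈? B) ×-dec ¬? (lookup X b ≟₀ 𝟎))
  ... | yes found = found
  ... | no none   = ⊥-elim (ind cX λ {x} q → x∉p⇒x∈∁p λ x∈B → none (x , x∈B , ∈supp⁻ q))

  rank-exists : ∀ {A I} → I ⊆ A → Independent O I → ¬ ¬ (∃[ k ] HasRank O A k)
  rank-exists {A} I⊆A indI none =
    maximal {P = λ I → I ⊆ A × Independent O I} (I⊆A , indI) λ (J , (J⊆A , indJ) , max) →
      none (∣ J ∣ , (J , J⊆A , indJ , refl) , λ p q → max (p , q))

  -- Adding `h` to the flat of rank `k` yields an independent set `J` of more than `k` elements on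
  -- which `U` and `V` vanish. A basis above `J` has at most `2 + k` elements, hence at most one
  -- outside `J`, and both `U` and `V` are nonzero there. Unless `U ≡± V`, eliminating it leaves a
  -- cocircuit that misses the basis.
  edge⇒line : IsEdge O (X ⊚ Y) → Line X Y
  edge⇒line {X} {Y} (_ , flat , k , (_ , rank) , A@((I , I⊆A , indI , _) , _)) {U} {V} {h}
            (cU , zU) (cV , zV) h∉ Uh Vh =
    decidable-stable (U ≡±? V) λ U≢±V →
      rank-exists (λ p → p⊆p∪q ⁅ h ⁆ (I⊆A p)) indI λ (l , R@((J , J⊆A , (B , basB , J⊆B) , ∣J∣≡l) , _)) →
        impossible U≢±V J⊆A basB J⊆B (subst (k <_) (sym ∣J∣≡l) (flat (λ p → h∉ (split (∈zeros⁻ p))) A R))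
    where
    split : ∀ {h} → lookup (X ⊚ Y) h ≡ 𝟎 → lookup X h ≡ 𝟎 × lookup Y h ≡ 𝟎
    split {h} p = ▹-zero⁻ (trans (sym (lookup-⊚ X Y h)) p)
    vanish : ∀ {W} → OnLine X Y W → lookup W h ≡ 𝟎 → ∀ {x} → x ∈ zeros (X ⊚ Y) ∪ ⁅ h ⁆ → lookup W x ≡ 𝟎
    vanish (_ , zW) Wh {x} p with x∈p∪q⁻ (zeros (X ⊚ Y)) _ p
    ... | inj₁ q = zW x (proj₁ (split (∈zeros⁻ q))) (proj₂ (split (∈zeros⁻ q)))
    ... | inj₂ q with refl ← x∈⁅y⁆⇒x≡y h q = Wh
    impossible : ¬ U ≡± V → ∀ {J B} → J ⊆ zeros (X ⊚ Y) ∪ ⁅ h ⁆ → Basis O B → J ⊆ B → k < ∣ J ∣ → ⊥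
    impossible U≢±V {J} {B} J⊆A basB J⊆B k<∣J∣ =
      let b , b∈B , Ub = cocircuit-meets-basis basB cU
          c , c∈B , Vc = cocircuit-meets-basis basB cV
          c≡b = unique c∈B (λ p → Vc (vanish (cV , zV) Vh (J⊆A p)))
                       b∈B (λ p → Ub (vanish (cU , zU) Uh (J⊆A p)))
          Z , cZ , Zb , Zh = support-elimination cU cV U≢±V Ub
                               (subst (λ b → lookup V b ≢ 𝟎) c≡b Vc)
          d , d∈B , Zd = cocircuit-meets-basis basB cZ
          d∉J p = Zd (Zh d (vanish (cU , zU) Uh (J⊆A p)) (vanish (cV , zV) Vh (J⊆A p)))
      in Zd (subst (λ b → lookup Z b ≡ 𝟎)
              (sym (unique d∈B d∉J b∈B (λ p → Ub (vanish (cU , zU) Uh (J⊆A p))))) Zb)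
      where
      unique : ∀ {x y} → x ∈ B → x ∉ J → y ∈ B → y ∉ J → x ≡ y
      unique {x} {y} x∈B x∉J y∈B y∉J = decidable-stable (x ≟ y) λ x≢y →
        ℕ.<⇒≱ (ℕ.+-monoʳ-< 2 k<∣J∣)
          (ℕ.≤-trans (two-missing J⊆B x∈B x∉J y∈B y∉J x≢y) (rank (λ _ → ∈⊤) (B , basB , λ p → p)))

-- Elimination on a line

▹-identityʳ : ∀ s → s ▹ 𝟎 ≡ s
▹-identityʳ ⊕ = refl
▹-identityʳ ⊖ = refl
▹-identityʳ 𝟎 = refl

·-𝟎-▹ : ∀ a → a · 𝟎 ▹ t ≡ t
·-𝟎-▹ Sign.+ = refl
·-𝟎-▹ Sign.- = refl

·-zero⁻ : ∀ a → a · s ≡ 𝟎 → s ≡ 𝟎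
·-zero⁻ Sign.+ p = p
·-zero⁻ Sign.- p = ⊝-zero⁻ p

·-⊝ : ∀ a s → a · ⊝ s ≡ ⊝ (a · s)
·-⊝ Sign.+ s = refl
·-⊝ Sign.- s = refl

·-involutive : ∀ a s → a · (a · s) ≡ s
·-involutive Sign.+ s = refl
·-involutive Sign.- s = ⊝-involutive s

·-injective : ∀ a → a · s ≡ a · t → s ≡ t
·-injective a p = trans (sym (·-involutive a _)) (trans (cong (a ·_) p) (·-involutive a _))

-- For conformal X and Y this says that D eliminates an element of supp X ∩ supp Y
-- between - X and Y.
Between : SignVector n → SignVector n → SignVector n → Set
Between X Y D = ∀ h → (lookup X h ≡ 𝟎 → lookup D h ≡ lookup Y h) ×
                      (lookup Y h ≡ 𝟎 → lookup D h ≡ ⊝ lookup X h)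

eliminates⇒between : (∀ h → h ∉ sep (- X) Y → lookup Z h ≡ lookup (- X ⊚ Y) h) → Between X Y Z
eliminates⇒between {X = X} {Y} {Z} elim h = left , right
  where
  value : lookup (- X ⊚ Y) h ≡ ⊝ lookup X h ▹ lookup Y h
  value = trans (lookup-⊚ (- X) Y h) (cong (_▹ lookup Y h) (lookup-neg X h))
  left : lookup X h ≡ 𝟎 → lookup Z h ≡ lookup Y h
  left p = trans (elim h λ q → proj₂ (∈sep⁻ {X = - X} {Y} q) (neg-zero {X = X} p))
                 (trans value (cong (λ s → ⊝ s ▹ lookup Y h) p))
  right : lookup Y h ≡ 𝟎 → lookup Z h ≡ ⊝ lookup X h
  right p = trans (elim h λ q → let eq , ne = ∈sep⁻ {X = - X} {Y} q in ne (trans eq (cong ⊝_ p)))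
                  (trans value (trans (cong (⊝ lookup X h ▹_) p) (▹-identityʳ _)))

conformal-agree : Conformal X Y → ∀ h → lookup X h ≢ 𝟎 → lookup Y h ≢ 𝟎 → lookup X h ≡ lookup Y h
conformal-agree {X = X} {Y} conf h x y with nonzero-signs x y
... | inj₁ same = same
... | inj₂ opp  = ⊥-elim (conf (h , ∈sep⁺ {X = X} {Y = Y} opp x))

between⇒eliminates : Conformal X Y → Between X Y Z →
                     ∀ h → h ∉ sep (- X) Y → lookup Z h ≡ lookup (- X ⊚ Y) h
between⇒eliminates {X = X} {Y} {Z} conf betw h h∉ =
  trans go (sym (trans (lookup-⊚ (- X) Y h) (cong (_▹ lookup Y h) (lookup-neg X h))))
  where
  go : lookup Z h ≡ ⊝ lookup X h ▹ lookup Y h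
  go with lookup X h ≟₀ 𝟎 | lookup Y h ≟₀ 𝟎
  ... | yes p | _ = trans (proj₁ (betw h) p) (cong (λ s → ⊝ s ▹ lookup Y h) (sym p))
  ... | no _ | yes q =
    trans (proj₂ (betw h) q) (trans (sym (▹-identityʳ _)) (cong (⊝ lookup X h ▹_) (sym q)))
  ... | no p | no q = ⊥-elim (h∉ (∈sep⁺ {X = - X} {Y = Y}
    (trans (lookup-neg X h) (cong ⊝_ (conformal-agree {X = X} {Y} conf h p q)))
    (λ r → p (⊝-zero⁻ (trans (sym (lookup-neg X h)) r)))))

conformal-sym : Conformal X Y → Conformal Y X
conformal-sym {X = X} {Y} conf (h , p) with eq , ne ← ∈sep⁻ {X = Y} {X} p =
  conf (h , ∈sep⁺ {X = X} {Y = Y} (trans (sym (⊝-involutive _)) (cong ⊝_ (sym eq)))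
    (λ q → ne (trans eq (cong ⊝_ q))))

conformal-neg : Conformal X Y → Conformal (- X) (- Y)
conformal-neg {X = X} {Y} conf (h , p) with eq , ne ← ∈sep⁻ {X = - X} { - Y} p =
  conf (h , ∈sep⁺ {X = X} {Y = Y}
    (·-injective Sign.- (trans (sym (lookup-neg X h)) (trans eq (cong ⊝_ (lookup-neg Y h)))))
    (λ q → ne (neg-zero {X = X} q)))

⊚-comm : Conformal X Y → X ⊚ Y ≡ Y ⊚ X
⊚-comm {X = X} {Y} conf = lookup-ext λ h →
  trans (lookup-⊚ X Y h) (trans (go h) (sym (lookup-⊚ Y X h)))
  where
  go : ∀ h → lookup X h ▹ lookup Y h ≡ lookup Y h ▹ lookup X h
  go h with lookup X h ≟₀ 𝟎 | lookup Y h ≟₀ 𝟎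
  ... | yes p | _     = trans (cong (_▹ lookup Y h) p)
                          (sym (trans (cong (lookup Y h ▹_) p) (▹-identityʳ _)))
  ... | no _  | yes q = trans (trans (cong (lookup X h ▹_) q) (▹-identityʳ _))
                          (sym (cong (_▹ lookup X h) q))
  ... | no p  | no q  = trans (▹-nonzero p) (trans (conformal-agree {X = X} {Y} conf h p q)
                          (sym (▹-nonzero q)))

neg-⊚ : ∀ (X Y : SignVector n) → - (X ⊚ Y) ≡ - X ⊚ - Y
neg-⊚ []      []      = refl
neg-⊚ (⊕ ∷ X) (y ∷ Y) = cong (_ ∷_) (neg-⊚ X Y)
neg-⊚ (⊖ ∷ X) (y ∷ Y) = cong (_ ∷_) (neg-⊚ X Y)
neg-⊚ (𝟎 ∷ X) (y ∷ Y) = cong (_ ∷_) (neg-⊚ X Y)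

supp-neg : ∀ (X : SignVector n) → supp (- X) ≡ supp X
supp-neg []      = refl
supp-neg (⊕ ∷ X) = cong (_ ∷_) (supp-neg X)
supp-neg (⊖ ∷ X) = cong (_ ∷_) (supp-neg X)
supp-neg (𝟎 ∷ X) = cong (_ ∷_) (supp-neg X)

⊚-identityʳ : ∀ (X : SignVector n) → X ⊚ replicate n 𝟎 ≡ X
⊚-identityʳ []      = refl
⊚-identityʳ (x ∷ X) = cong₂ _∷_ (▹-identityʳ x) (⊚-identityʳ X)

neg-replicate : ∀ n → - replicate n 𝟎 ≡ replicate n 𝟎
neg-replicate zero    = refl
neg-replicate (suc n) = cong (𝟎 ∷_) (neg-replicate n)

module _ (O : OrientedMatroid n) where
  open OrientedMatroid O

  edge-neg : ∀ {F} → IsEdge O F → IsEdge O (- F)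
  edge-neg {F} (cov , rest) = neg-covector cov ,
    subst (λ S → IsFlat O (∁ S) × ∃[ k ] HasRank O ⊤ (2 + k) × HasRank O (∁ S) k) (sym (supp-neg F)) rest
    where
    neg-covector : ∀ {F} → Covector O F → Covector O (- F)
    neg-covector zero-covector = subst (Covector O) (sym (neg-replicate n)) zero-covector
    neg-covector (compose {X} {F} c cov) =
      subst (Covector O) (sym (neg-⊚ X F)) (compose (symmetric c) (neg-covector cov))

  comodular-neg : Comodular O X Y → Comodular O (- X) (- Y)
  comodular-neg {X} {Y} (cX , cY , X≢Y , X≢-Y , edge) =
    symmetric cX , symmetric cY ,
    (λ p → X≢Y (trans (sym (neg-involutive X)) (trans (cong -_ p) (neg-involutive Y)))) ,
    (λ p → X≢-Y (trans (sym (neg-involutive X)) (trans (cong -_ p) (neg-involutive (- Y))))) ,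
    subst (IsEdge O) (neg-⊚ X Y) (edge-neg edge)

  comodular-sym : Conformal X Y → Comodular O X Y → Comodular O Y X
  comodular-sym {X} {Y} conf (cX , cY , X≢Y , X≢-Y , edge) =
    cY , cX , X≢Y ∘ sym , (λ p → X≢-Y (trans (sym (neg-involutive X)) (cong -_ (sym p)))) ,
    subst (IsEdge O) (⊚-comm {X = X} {Y} conf) edge

  comodular⇒≢± : Comodular O X Y → ¬ X ≡± Y
  comodular⇒≢± (_ , _ , X≢Y , X≢-Y , _) = [ X≢Y , X≢-Y ]′

  comodular⇒line : Comodular O X Y → Line O X Y
  comodular⇒line (_ , _ , _ , _ , edge) = edge⇒line O edge

  onLine-neg : OnLine O X Y U → OnLine O X Y (- U)
  onLine-neg {U = U} (cU , zU) = symmetric cU , λ h p q → neg-zero {X = U} (zU h p q)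

  -- A cocircuit supported on `f` alone would, by incomparability, force `X` and `Y` to vanish at
  -- `f`, since they are nonzero at `e`; then `Z` would vanish there too. So if `Z` is nonzero at
  -- `f`, some cobasis contains `f`.
  coloop-between : Cocircuit X → Cocircuit Y → Between X Y Z → lookup X e ≢ 𝟎 → lookup Y e ≢ 𝟎 →
                   e ≢ f → IsColoop O f → lookup Z f ≡ 𝟎
  coloop-between {X} {Y} {Z} {e} {f} cX cY betw Xe Ye e≢f coloop =
    decidable-stable (_ ≟₀ _) λ Zf → cobasis-above O (coind Zf) λ (T , cobT , sub) →
      x∈∁p⇒x∉p (coloop (cobasis⇒basis O cobT)) (sub (x∈⁅x⁆ f))
    where
    module _ {C} (cC : Cocircuit C) (sub : supp C ⊆ ⁅ f ⁆) where
      vanish : ∀ {W} → Cocircuit W → lookup W e ≢ 𝟎 → lookup W f ≡ 𝟎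
      vanish {W} cW We = decidable-stable (_ ≟₀ _) λ Wf →
        We (≡±-zero (≡±-sym (incomparable cC cW λ {x} p →
          ∈supp⁺ (subst (λ x → lookup W x ≢ 𝟎) (sym (x∈⁅y⁆⇒x≡y f (sub p))) Wf)))
          (decidable-stable (_ ≟₀ _) λ Ce → e≢f (x∈⁅y⁆⇒x≡y f (sub (∈supp⁺ Ce)))))
    coind : lookup Z f ≢ 𝟎 → Coindependent O ⁅ f ⁆
    coind Zf {C} cC sub =
      Zf (trans (proj₁ (betw f) (vanish cC sub cX Xe)) (vanish cC sub cY Ye))

  -- The axiom restricts `Z` only where it is nonzero. On a line, `Z` cannot vanish where exactly
  -- one of `X` and `Y` does: it would equal that one up to sign, although it vanishes at `e`.
  eliminate : Conformal X Y → Comodular O X Y → lookup X e ≢ 𝟎 → lookup Y e ≢ 𝟎 →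
              ∃[ Z ] Cocircuit Z × lookup Z e ≡ 𝟎 × Between X Y Z
  eliminate {X} {Y} {e} conf com@(cX , cY , X≢Y , _) Xe Ye
    with Z , cZ , Ze , Zh ← elimination (symmetric cX) cY
           (λ p → X≢Y (trans (sym (neg-involutive X)) (trans (cong -_ p) (neg-involutive Y))))
           (∈sep⁺ {X = - X} {Y = Y}
             (trans (lookup-neg X e) (cong ⊝_ (conformal-agree {X = X} {Y} conf e Xe Ye)))
             (λ p → Xe (⊝-zero⁻ (trans (sym (lookup-neg X e)) p))))
    = Z , cZ , Ze , λ h → left h , right h
    where
    onX : OnLine O X Y X
    onX = cX , λ _ p _ → p
    onY : OnLine O X Y Y
    onY = cY , λ _ _ p → p
    onZ : OnLine O X Y Z
    onZ = cZ , λ h p q → decidable-stable (_ ≟₀ _) λ r →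
      r ([ (λ u → trans u (neg-zero {X = X} p)) , (λ u → trans u q) ]′ (Zh h r))
    left : ∀ h → lookup X h ≡ 𝟎 → lookup Z h ≡ lookup Y h
    left h p with lookup Z h ≟₀ 𝟎 | lookup Y h ≟₀ 𝟎
    ... | yes r | yes q = trans r (sym q)
    ... | yes r | no q  = ⊥-elim (Xe (≡±-zero (comodular⇒line com onX onZ (q ∘ proj₂) p r) Ze))
    ... | no r  | _     = [ (λ u → ⊥-elim (r (trans u (neg-zero {X = X} p)))) , (λ u → u) ]′ (Zh h r)
    right : ∀ h → lookup Y h ≡ 𝟎 → lookup Z h ≡ ⊝ lookup X h
    right h q with lookup Z h ≟₀ 𝟎 | lookup X h ≟₀ 𝟎
    ... | yes r | yes p = trans r (cong ⊝_ (sym p))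
    ... | yes r | no p  = ⊥-elim (Ye (≡±-zero (comodular⇒line com onY onZ (p ∘ proj₁) q r) Ze))
    ... | no r  | _     = [ (λ u → trans u (lookup-neg X h)) , (λ u → ⊥-elim (r (trans u q))) ]′ (Zh h r)

  -- Elements e and f that vanish at the same cocircuit Z of a line are parallel or antiparallel on it.
  parallel-signs : Line O X Y → OnLine O X Y Z → OnLine O X Y U → OnLine O X Y V →
    lookup Z e ≡ 𝟎 → lookup Z f ≡ 𝟎 → ¬ (lookup X f ≡ 𝟎 × lookup Y f ≡ 𝟎) →
    ¬ (lookup X e ≡ 𝟎 × lookup Y e ≡ 𝟎) →
    lookup U e ≢ 𝟎 → lookup U e ≡ lookup V e → lookup U f ≡ lookup V f
  parallel-signs {X} {Y} {Z} {U} {V} {e} {f} line onZ onU@(cU , zU) onV@(cV , zV) Ze Zf f∉ e∉ Ue UVe =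
    decidable-stable (_ ≟₀ _) λ differ →
      clash ([ (λ p → ⊥-elim (differ p)) , (λ p → p) ]′ (nonzero-signs Uf Vf))
    where
    Ve : lookup V e ≢ 𝟎
    Ve = subst (_≢ 𝟎) UVe Ue
    Uf : lookup U f ≢ 𝟎
    Uf p = Ue (≡±-zero (line onU onZ f∉ p Zf) Ze)
    Vf : lookup V f ≢ 𝟎
    Vf p = Ve (≡±-zero (line onV onZ f∉ p Zf) Ze)
    U≢-V : U ≢ - V
    U≢-V p = Ue (fixed⇒zero (trans (trans (cong (λ W → lookup W e) p) (lookup-neg V e)) (cong ⊝_ (sym UVe))))
    nonvanishing : ∀ {A B W h} → OnLine O X Y A → OnLine O X Y B → OnLine O X Y W →
      lookup W e ≡ 𝟎 → lookup B e ≢ 𝟎 → lookup A h ≢ 𝟎 → lookup B h ≡ 𝟎 → lookup W h ≢ 𝟎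
    nonvanishing (_ , zA) onB onW We Be Ah Bh Wh =
      Be (≡±-zero (line onB onW (λ (p , q) → Ah (zA _ p q)) Bh Wh) We)
    module _ (opp : lookup U f ≡ ⊝ lookup V f) where
      U≢V : U ≢ V
      U≢V p = Uf (fixed⇒zero (trans opp (cong (λ W → ⊝ lookup W f) (sym p))))
      clash : ⊥
      clash
        -- `W` eliminates `f` between `U` and `V`, and `W′` eliminates `e` between `U` and `- V`.
        -- Both vanish at `f`, so they agree up to sign. But they coincide at `h` and are opposite
        -- at `k`, with nonzero entries at both.
        with W , cW , Wf , Wh ← elimination cU cV U≢-V (∈sep⁺ {X = U} {Y = V} opp Uf)
           | W′ , cW′ , W′e , W′h ← elimination cU (symmetric cV)
               (λ p → U≢V (trans p (neg-involutive V)))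
               (∈sep⁺ {X = U} {Y = - V}
                 (trans UVe (trans (sym (⊝-involutive _)) (cong ⊝_ (sym (lookup-neg V e))))) Ue)
           | h , Uh , Vh ← escape O cU cV [ U≢V , U≢-V ]′
           | k , Vk , Uk ← escape O cV cU ([ U≢V , U≢-V ]′ ∘ ≡±-sym)
        = [ (λ p → Vk (fixed⇒zero (trans (sym W-k) (trans (cong (λ W → lookup W k) p) W′-k))))
          , (λ p → Uh (fixed⇒zero (trans (sym W-h) (trans (cong (λ W → lookup W h) p)
              (trans (lookup-neg W′ h) (cong ⊝_ W′-h)))))) ]′
          (line onW onW′ f∉ Wf (≡±-zero (line onW′ onZ e∉ W′e Ze) Zf))
        where
        onW : OnLine O X Y W
        onW = cW , λ h p q → decidable-stable (_ ≟₀ _) λ r →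
          r ([ (λ u → trans u (zU h p q)) , (λ u → trans u (zV h p q)) ]′ (Wh h r))
        onW′ : OnLine O X Y W′
        onW′ = cW′ , λ h p q → decidable-stable (_ ≟₀ _) λ r →
          r ([ (λ u → trans u (zU h p q)) , (λ u → trans u (neg-zero {X = V} (zV h p q))) ]′ (W′h h r))
        We : lookup W e ≡ 𝟎
        We = ≡±-zero (line onW onZ f∉ Wf Zf) Ze
        W-h : lookup W h ≡ lookup U h
        W-h = let ne = nonvanishing onU onV onW We Ve Uh Vh in
          [ (λ u → u) , (λ u → ⊥-elim (ne (trans u Vh))) ]′ (Wh h ne)
        W′-h : lookup W′ h ≡ lookup U h
        W′-h = let ne = nonvanishing onU onV onW′ W′e Ve Uh Vh in
          [ (λ u → u) , (λ u → ⊥-elim (ne (trans u (neg-zero {X = V} Vh)))) ]′ (W′h h ne)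
        W-k : lookup W k ≡ lookup V k
        W-k = let ne = nonvanishing onV onU onW We Ue Vk Uk in
          [ (λ u → ⊥-elim (ne (trans u Uk))) , (λ u → u) ]′ (Wh k ne)
        W′-k : lookup W′ k ≡ ⊝ lookup V k
        W′-k = let ne = nonvanishing onV onU onW′ W′e Ue Vk Uk in
          [ (λ u → ⊥-elim (ne (trans u Uk))) , (λ u → trans u (lookup-neg V k)) ]′ (W′h k ne)

-- Single-element extensions

module _ (O : OrientedMatroid n) where
  open OrientedMatroid O

  cocircuit≢-conformal : Cocircuit X → Conformal X Y → X ≢ - Y
  cocircuit≢-conformal {X} {Y} cX conf p = nonzero (subst Cocircuit (lookup-ext λ h →
    trans (decidable-stable (_ ≟₀ _) λ q → conf (h , ∈sep⁺ {X = X} {Y = Y} (opp h) q))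
          (sym (lookup-replicate h 𝟎))) cX)
    where
    opp : ∀ h → lookup X h ≡ ⊝ lookup Y h
    opp h = trans (cong (λ W → lookup W h) p) (lookup-neg Y h)

module _ (O : OrientedMatroid n) (σ : SignVector n → Sign₀) (O∪p : OrientedMatroid (suc n))
         (ext : IsExtension O σ O∪p) where
  private
    module O = OrientedMatroid O
    module P = OrientedMatroid O∪p

  old-cocircuit : P.Cocircuit (s ∷ Y) → s ≢ 𝟎 → O.Cocircuit Y × σ Y ≡ s
  old-cocircuit {s} {Y} c = go (Equivalence.to (ext _) c) refl
    where
    go : ∀ {Z} → ExtensionCocircuit O σ Z → Z ≡ s ∷ Y → s ≢ 𝟎 → O.Cocircuit Y × σ Y ≡ s
    go (old c)       refl _  = c , refl
    go (new _ _ _ _) refl ne = ⊥-elim (ne refl)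

  -- The inversion of `ExtensionCocircuit` at entry `𝟎` for p. The shape `W ⊚ W′` appears in an
  -- equation so that `D` can be any vector.
  data ZeroCocircuit (D : SignVector n) : Set where
    old : O.Cocircuit D → σ D ≡ 𝟎 → ZeroCocircuit D
    new : ∀ {W W′} → Conformal W W′ → Comodular O W W′ → σ W ≡ ⊝ σ W′ → σ W ≢ 𝟎 →
          D ≡ W ⊚ W′ → ZeroCocircuit D

  zero-cocircuit : P.Cocircuit (𝟎 ∷ D) → ZeroCocircuit D
  zero-cocircuit {D} c = go (Equivalence.to (ext _) c) refl
    where
    go : ∀ {Z} → ExtensionCocircuit O σ Z → Z ≡ 𝟎 ∷ D → ZeroCocircuit D
    go (old c) eq = old (subst O.Cocircuit (cong Vec.tail eq) c)
                        (trans (cong σ (sym (cong Vec.tail eq))) (cong Vec.head eq))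
    go (new conf com opp ne) refl = new conf com opp ne refl

  -- Outside p, each cocircuit of O ∪ p contains the support of a cocircuit of `O`. Together with
  -- the converse this identifies the cobases of O ∪ p through p with those of `O`: deleting p gives
  -- back `O`.
  coindependent⁺ : ∀ {S} → Coindependent O S → Coindependent O∪p (inside ∷ S)
  coindependent⁺ {S} ind {Z} cZ = go (Equivalence.to (ext Z) cZ)
    where
    go : ∀ {Z} → ExtensionCocircuit O σ Z → supp Z ⊈ inside ∷ S
    go (old c) sub = ind c (drop-∷-⊆ sub)
    go (new {Y¹} {Y²} _ (c , _) _ _) sub = ind c λ {x} q → drop-∷-⊆ sub (∈supp⁺ λ r →
      ∈supp⁻ q (proj₁ (▹-zero⁻ (trans (sym (lookup-⊚ Y¹ Y² x)) r))))

  coindependent⁻ : ∀ {S} → Coindependent O∪p (inside ∷ S) → Coindependent O S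
  coindependent⁻ {S} ind {Y} c sub = ind (Equivalence.from (ext _) (old c)) sub′
    where
    sub′ : supp (σ Y ∷ Y) ⊆ inside ∷ S
    sub′ {zero}  _         = here
    sub′ {suc x} (there q) = there (sub q)

  cobasis⁺ : ∀ {S} → Cobasis O S → Cobasis O∪p (inside ∷ S)
  cobasis⁺ {S} (ind , max) = coindependent⁺ ind , go
    where
    go : ∀ {T} → Coindependent O∪p T → inside ∷ S ⊆ T → T ⊆ inside ∷ S
    go {x ∷ T} indT sub with sub here
    ... | here = in⊆in (max (coindependent⁻ indT) (drop-∷-⊆ sub))

  cobasis⁻ : ∀ {S} → Cobasis O∪p (inside ∷ S) → Cobasis O S
  cobasis⁻ {S} (ind , max) = coindependent⁻ ind , λ indT sub →
    drop-∷-⊆ (max (coindependent⁺ indT) (in⊆in sub))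

  -- This says that p is not a coloop: `⁅ zero ⁆` is `inside ∷ ∅`, and no cocircuit of `O` is zero.
  p-coindependent : Coindependent O∪p ⁅ zero ⁆
  p-coindependent = coindependent⁺ λ {X} cX sub → O.nonzero (subst O.Cocircuit
    (lookup-ext λ h → trans (decidable-stable (_ ≟₀ _) λ q → ∉⊥ (sub (∈supp⁺ {X = X} q)))
                            (sym (lookup-replicate h 𝟎))) cX)

  -- Exchanging p into the cobasis releases an element `d` of the old ground set, which takes the
  -- place of p in the basis.
  basis-avoiding-p : ∀ {B} → Basis O∪p (inside ∷ B) → ∃[ B′ ] Basis O B′ × B ⊂ B′
  basis-avoiding-p {B} basB
    with exchange O∪p {p = zero} basB (λ ()) p-coindependent
  ... | suc d , there d∈ , cob = ∁ S , cobasis⇒basis O (cobasis⁻ cob) ,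
        (λ {x} x∈B → x∉p⇒x∈∁p λ x∈S → x∈p⇒x∉∁p x∈B (proj₁ (from x∈S)) ) ,
        d , (x∉p⇒x∈∁p λ d∈S → proj₂ (from d∈S) refl) , x∈∁p⇒x∉p d∈
    where
    S = (∁ B ─ ⁅ d ⁆) ∪ ∅
    from : ∀ {x} → x ∈ S → x ∈ ∁ B × x ≢ d
    from {x} q with x∈p∪q⁻ (∁ B ─ ⁅ d ⁆) ∅ q
    ... | inj₂ r = ⊥-elim (∉⊥ r)
    ... | inj₁ r = p─q⊆p (∁ B) ⁅ d ⁆ r , λ { refl → x∉p-x (∁ B) r }

  independent⁺ : ∀ {I} → Independent O I → Independent O∪p (outside ∷ I)
  independent⁺ (B , basB , sub) = outside ∷ B , cobasis⁺ basB , s⊆s sub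

  independent⁻ : ∀ {I} → Independent O∪p (outside ∷ I) → Independent O I
  independent⁻ (outside ∷ B , basB , sub) = B , cobasis⁻ basB , drop-∷-⊆ sub
  independent⁻ (inside ∷ B , basB , sub) with B′ , basB′ , B⊆B′ , _ ← basis-avoiding-p basB =
    B′ , basB′ , λ p → B⊆B′ (drop-there (sub (there p)))

  hasRank⁺ : ∀ {A k} → HasRank O A k → HasRank O∪p (outside ∷ A) k
  hasRank⁺ {A} {k} ((I , I⊆A , indI , size) , max) =
    (outside ∷ I , s⊆s I⊆A , independent⁺ indI , size) , max′
    where
    max′ : ∀ {I} → I ⊆ outside ∷ A → Independent O∪p I → ∣ I ∣ ≤ k
    max′ {outside ∷ I} sub ind = max (drop-∷-⊆ sub) (independent⁻ ind)
    max′ {inside ∷ I}  sub ind with () ← sub here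

  hasRank⁻ : ∀ {A k} → HasRank O∪p (outside ∷ A) k → HasRank O A k
  hasRank⁻ ((outside ∷ I , I⊆A , indI , size) , max) =
    (I , drop-∷-⊆ I⊆A , independent⁻ indI , size) , λ sub ind → max (s⊆s sub) (independent⁺ ind)
  hasRank⁻ ((inside ∷ I , I⊆A , _) , _) with () ← I⊆A here

  -- A largest independent set may use p; the strict inclusion `B ⊂ B′` makes up for its loss.
  hasRank-⊤⁻ : ∀ {k} → HasRank O∪p ⊤ k → HasRank O ⊤ k
  hasRank-⊤⁻ {k} ((I , _ , (B , basB , I⊆B) , size) , max) =
    build (large B basB (subst (_≤ ∣ B ∣) size (p⊆q⇒∣p∣≤∣q∣ I⊆B)))
    where
    max′ : ∀ {I} → I ⊆ ⊤ → Independent O I → ∣ I ∣ ≤ k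
    max′ _ ind = max ⊆⊤ (independent⁺ ind)
    large : ∀ B → Basis O∪p B → k ≤ ∣ B ∣ → ∃[ B′ ] Basis O B′ × k ≤ ∣ B′ ∣
    large (outside ∷ B) basB le = B , cobasis⁻ basB , le
    large (inside ∷ B)  basB le with B′ , basB′ , B⊂B′ ← basis-avoiding-p basB =
      B′ , basB′ , ℕ.≤-trans le (p⊂q⇒∣p∣<∣q∣ B⊂B′)
    build : ∃[ B′ ] Basis O B′ × k ≤ ∣ B′ ∣ → HasRank O ⊤ k
    build (B′ , basB′ , le) =
      (B′ , ⊆⊤ , indB′ , ℕ.≤-antisym (max′ ⊆⊤ indB′) le) , max′
      where
      indB′ : Independent O B′
      indB′ = B′ , basB′ , λ q → q

  -- The entries `⊕` at p keep p out of the zero set of the edge, so its rank and flatness can be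
  -- tested in `O`.
  comodular⁻ : Conformal X Y → Comodular O∪p (⊕ ∷ X) (⊕ ∷ Y) → Comodular O X Y
  comodular⁻ {X} {Y} conf (cX , cY , X≢Y , _ , _ , flat , k , full , rank) =
    oX , oY , X≢Y ∘ cong (⊕ ∷_) , cocircuit≢-conformal O oX conf ,
    subst (Covector O) (cong (X ⊚_) (⊚-identityʳ Y)) (compose oX (compose oY zero-covector)) ,
    (λ {e} e∉ A R → flat {suc e} (λ { (there q) → e∉ q }) (hasRank⁺ A) (hasRank⁺ R)) ,
    k , hasRank-⊤⁻ full , hasRank⁻ rank
    where
    oX = proj₁ (old-cocircuit cX λ ())
    oY = proj₁ (old-cocircuit cY λ ())

  -- If σ is lexicographic along a line with leading element e, then p meets the line at the
  -- cocircuit Z of e or infinitesimally close to it, between Z and W.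
  locate : ∀ {a} (ρ : SignVector n → Sign₀) → Line O X Y → ¬ (lookup X e ≡ 𝟎 × lookup Y e ≡ 𝟎) →
    (∀ {U} → OnLine O X Y U → σ U ≡ a · lookup U e ▹ ρ U) →
    P.Cocircuit (𝟎 ∷ D) → (∀ h → lookup X h ≡ 𝟎 → lookup Y h ≡ 𝟎 → lookup D h ≡ 𝟎) →
    OnLine O X Y Z → lookup Z e ≡ 𝟎 → lookup Z h ≢ 𝟎 → lookup D h ≡ lookup Z h →
    (σ Z ≡ 𝟎 × D ≡ Z) ⊎
    ∃[ W ] OnLine O X Y W × σ Z ≢ 𝟎 × a · lookup W e ≡ ⊝ σ Z × D ≡ Z ⊚ W
  locate {X} {Y} {e} {D} {Z} {h} {a} ρ line e∉ lex cD zD onZ Ze Zh DZ = go (zero-cocircuit cD)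
    where
    leading : ∀ {U} → OnLine O X Y U → lookup U e ≢ 𝟎 → σ U ≡ a · lookup U e
    leading onU Ue = trans (lex onU) (▹-nonzero (Ue ∘ ·-zero⁻ a))

    Case = (σ Z ≡ 𝟎 × D ≡ Z) ⊎
           ∃[ W ] OnLine O X Y W × σ Z ≢ 𝟎 × a · lookup W e ≡ ⊝ σ Z × D ≡ Z ⊚ W

    -- The element `h` tells `Z` from `- Z`, since `D` and `Z` share a nonzero entry there.
    not-neg : ∀ {U} → lookup U h ≢ 𝟎 → lookup D h ≡ lookup U h → U ≢ - Z
    not-neg {U} Uh DU p = Zh (fixed⇒zero (trans (sym DZ) (trans DU
      (trans (cong (λ W → lookup W h) p) (lookup-neg Z h)))))

    at-Z : ∀ {W W′} → OnLine O X Y W → OnLine O X Y W′ → Comodular O W W′ → σ W ≡ ⊝ σ W′ → σ W ≢ 𝟎 →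
           D ≡ W ⊚ W′ → lookup W e ≡ 𝟎 → Case
    at-Z {W} {W′} onW onW′ com opp ne D≡ We with line onW onZ e∉ We Ze
    ... | inj₂ refl = ⊥-elim (not-neg Wh (trans (cong (λ F → lookup F h) D≡)
                        (trans (lookup-⊚ (- Z) W′ h) (▹-nonzero Wh))) refl)
      where
      Wh : lookup (- Z) h ≢ 𝟎
      Wh q = Zh (⊝-zero⁻ (trans (sym (lookup-neg Z h)) q))
    ... | inj₁ refl = inj₂ (W′ , onW′ , ne , trans (sym (leading onW′ W′e))
                        (trans (sym (⊝-involutive _)) (cong ⊝_ (sym opp))) , D≡)
      where
      W′e : lookup W′ e ≢ 𝟎
      W′e q = comodular⇒≢± O com (line onW onW′ e∉ We q)

    go : ZeroCocircuit D → Case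
    go (old c σD) = inj₁ ([ (λ { refl → σD , refl })
                          , (λ p → ⊥-elim (not-neg (λ q → Zh (trans (sym DZ) q)) refl p)) ]′
                          (line onD onZ e∉ De Ze))
      where
      onD : OnLine O X Y D
      onD = c , zD
      De : lookup D e ≡ 𝟎
      De = ·-zero⁻ a (proj₁ (▹-zero⁻ (trans (sym (lex onD)) σD)))
    go (new {W} {W′} conf com@(cW , cW′ , _) opp ne D≡) = split (lookup W e ≟₀ 𝟎) (lookup W′ e ≟₀ 𝟎)
      where
      zeroBoth : ∀ k → lookup X k ≡ 𝟎 → lookup Y k ≡ 𝟎 → lookup W k ≡ 𝟎 × lookup W′ k ≡ 𝟎
      zeroBoth k p q = ▹-zero⁻ (trans (sym (lookup-⊚ W W′ k))
                                      (trans (cong (λ F → lookup F k) (sym D≡)) (zD k p q)))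
      onW : OnLine O X Y W
      onW = cW , λ k p q → proj₁ (zeroBoth k p q)
      onW′ : OnLine O X Y W′
      onW′ = cW′ , λ k p q → proj₂ (zeroBoth k p q)
      opp′ : σ W′ ≡ ⊝ σ W
      opp′ = trans (sym (⊝-involutive _)) (cong ⊝_ (sym opp))
      ne′ : σ W′ ≢ 𝟎
      ne′ q = ne (trans opp (cong ⊝_ q))
      split : Dec (lookup W e ≡ 𝟎) → Dec (lookup W′ e ≡ 𝟎) → Case
      split (yes We) _ = at-Z onW onW′ com opp ne D≡ We
      split (no _) (yes W′e) =
        at-Z onW′ onW (comodular-sym O {W} {W′} conf com) opp′ ne′
             (trans D≡ (⊚-comm {X = W} {W′} conf)) W′e
      -- If neither vanished at `e`, their values under `σ` would be read off at `e`, and being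
      -- opposite would contradict conformality.
      split (no We) (no W′e) = ⊥-elim (conf (e , ∈sep⁺ {X = W} {Y = W′}
        (·-injective a (trans (sym (leading onW We)) (trans opp
          (trans (cong ⊝_ (leading onW′ W′e)) (sym (·-⊝ a _)))))) We))

-- Directed cycles

-- `DirectedCycle` with arbitrary relations for directed and undirected steps, so that cycles can be
-- negated and reversed.
record Cycle (R S : SignVector n → SignVector n → Set) : Set where
  field
    {m}      : ℕ
    vertex   : Fin (suc m) → SignVector n
    closed   : vertex (fromℕ m) ≡ vertex zero
    distinct : Injective _≡_ _≡_ (vertex ∘ inject₁)
    step     : ∀ i → R (vertex (inject₁ i)) (vertex (suc i)) ⊎ S (vertex (inject₁ i)) (vertex (suc i))
    directed : ∃[ i ] R (vertex (inject₁ i)) (vertex (suc i))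

map-cycle : ∀ {R S R′ S′ : SignVector n → SignVector n → Set} (φ : SignVector n → SignVector n) →
            Injective _≡_ _≡_ φ → (∀ {X Y} → R X Y → R′ (φ X) (φ Y)) → (∀ {X Y} → S X Y → S′ (φ X) (φ Y)) →
            Cycle R S → Cycle R′ S′
map-cycle φ inj r s C = record
  { vertex   = φ ∘ vertex
  ; closed   = cong φ closed
  ; distinct = λ p → distinct (inj p)
  ; step     = Sum.map r s ∘ step
  ; directed = proj₁ directed , r (proj₂ directed)
  }
  where open Cycle C

opposite-fromℕ : ∀ n → opposite (fromℕ n) ≡ zero
-- `fromℕ n` is `opposite zero` by computation.
opposite-fromℕ n = opposite-involutive {suc n} zero

opposite-inject₁ : ∀ {n} (i : Fin n) → opposite (inject₁ i) ≡ suc (opposite i)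
opposite-inject₁ {suc n} zero    = refl
opposite-inject₁ {suc n} (suc i) = cong inject₁ (opposite-inject₁ i)

-- Reversal leaves out position zero instead of the last one; both carry the same vertex.
distinct-suc : ∀ {m} {A : Set} (x : Fin (suc m) → A) → x (fromℕ m) ≡ x zero →
               Injective _≡_ _≡_ (x ∘ inject₁) → Injective _≡_ _≡_ (x ∘ suc)
distinct-suc {suc m} x closed inj {i} {j} p with view i | view j
... | ‵fromℕ     | ‵fromℕ     = refl
... | ‵fromℕ     | ‵inject₁ k with () ← inj {zero} {suc k} (trans (sym closed) p)
... | ‵inject₁ k | ‵fromℕ     with () ← inj {suc k} {zero} (trans p closed)
... | ‵inject₁ k | ‵inject₁ l with refl ← inj {suc k} {suc l} p = refl

reverse : ∀ {R S R′ S′ : SignVector n → SignVector n → Set} → (∀ {X Y} → R X Y → R′ Y X) →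
          (∀ {X Y} → S X Y → S′ Y X) → Cycle R S → Cycle R′ S′
reverse {R = R} {S} {R′} {S′} r s C = record
  { vertex   = x
  ; closed   = trans (cong vertex (opposite-fromℕ m)) (sym closed)
  ; distinct = λ {i} {j} p → opposite-injective (distinct-suc vertex closed distinct
                 (trans (sym (before i)) (trans p (before j))))
  ; step     = λ i → Sum.map (turn R′ r i) (turn S′ s i) (step (opposite i))
  ; directed = opposite (proj₁ directed) , turn R′ r (opposite (proj₁ directed))
                 (subst (λ i → R (vertex (inject₁ i)) (vertex (suc i)))
                   (sym (opposite-involutive (proj₁ directed))) (proj₂ directed))
  }
  where
  open Cycle C
  x : Fin (suc m) → SignVector _
  x = vertex ∘ opposite
  before : ∀ i → x (inject₁ i) ≡ vertex (suc (opposite i))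
  before i = cong vertex (opposite-inject₁ i)
  opposite-injective : ∀ {i j : Fin m} → opposite i ≡ opposite j → i ≡ j
  opposite-injective p =
    trans (sym (opposite-involutive _)) (trans (cong opposite p) (opposite-involutive _))
  turn : ∀ {Q : SignVector _ → SignVector _ → Set} (Q′ : SignVector _ → SignVector _ → Set) →
         (∀ {X Y} → Q X Y → Q′ Y X) → ∀ i →
         Q (vertex (inject₁ (opposite i))) (vertex (suc (opposite i))) → Q′ (x (inject₁ i)) (x (suc i))
  turn Q′ q i p = subst (λ X → Q′ X (x (suc i))) (sym (before i)) (q p)

-- The property is carried from `j` to the end, across the closing identification, and from zero on
-- to `k`.
around : ∀ {m} (Q : Fin (suc m) → Set) → (∀ i → Q (inject₁ i) → Q (suc i)) →
         (Q (fromℕ m) → Q zero) → ∀ {j k} → Q j → Q k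
around {m} Q next wrap {j} {k} q = forward Q next k (wrap (finish Q next j q))
  where
  forward : ∀ {m} (Q : Fin (suc m) → Set) → (∀ i → Q (inject₁ i) → Q (suc i)) → ∀ k → Q zero → Q k
  forward         Q next zero    q = q
  forward {suc m} Q next (suc k) q = forward (Q ∘ suc) (next ∘ suc) k (next zero q)
  finish : ∀ {m} (Q : Fin (suc m) → Set) → (∀ i → Q (inject₁ i) → Q (suc i)) → ∀ j → Q j → Q (fromℕ m)
  finish {m}     Q next zero    q = forward Q next (fromℕ m) q
  finish {suc m} Q next (suc j) q = finish (Q ∘ suc) (next ∘ suc) j q

between-neg : Between X Y Z → Between (- X) (- Y) (- Z)
between-neg {X = X} {Y} {Z} betw h =
  (λ p → trans (lookup-neg Z h) (trans (cong ⊝_ (proj₁ (betw h) (⊝-zero⁻ (trans (sym (lookup-neg X h)) p))))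
                                       (sym (lookup-neg Y h)))) ,
  (λ p → trans (lookup-neg Z h) (cong ⊝_ (trans (proj₂ (betw h) (⊝-zero⁻ (trans (sym (lookup-neg Y h)) p)))
                                                (sym (lookup-neg X h)))))

between-sym : Between X Y Z → Between Y X (- Z)
between-sym {Z = Z} betw h =
  (λ p → trans (lookup-neg Z h) (trans (cong ⊝_ (proj₂ (betw h) p)) (⊝-involutive _))) ,
  (λ p → trans (lookup-neg Z h) (cong ⊝_ (proj₁ (betw h) p)))

between-vanishes : Between X Y D → ∀ h → lookup X h ≡ 𝟎 → lookup Y h ≡ 𝟎 → lookup D h ≡ 𝟎
between-vanishes betw h p q = trans (proj₁ (betw h) p) q

-- Acyclicity of the programs (O , e , f)

module _ (O : OrientedMatroid n) where
  open OrientedMatroid O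

  -- The steps of the program (O , e , f), on either side a of the hyperplane of e.
  Link : Fin n → Fin n → Sign₀ → Sign₀ → SignVector n → SignVector n → Set
  Link e f a s X Y = lookup X e ≡ a × lookup Y e ≡ a × Conformal X Y × Comodular O X Y ×
                     ∃[ Z ] Cocircuit Z × lookup Z e ≡ 𝟎 × Between X Y Z × lookup Z f ≡ s

  link-neg : ∀ {a} → Link e f a s X Y → Link e f (⊝ a) (⊝ s) (- X) (- Y)
  link-neg {e} {f} {X = X} {Y} (Xe , Ye , conf , com , Z , cZ , Ze , betw , Zf) =
    trans (lookup-neg X e) (cong ⊝_ Xe) , trans (lookup-neg Y e) (cong ⊝_ Ye) ,
    conformal-neg {X = X} {Y} conf , comodular-neg O com ,
    - Z , symmetric cZ , neg-zero {X = Z} Ze , between-neg {X = X} {Y} {Z} betw ,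
    trans (lookup-neg Z f) (cong ⊝_ Zf)

  link-sym : ∀ {a} → Link e f a s X Y → Link e f a (⊝ s) Y X
  link-sym {e} {f} {X = X} {Y} (Xe , Ye , conf , com , Z , cZ , Ze , betw , Zf) =
    Ye , Xe , conformal-sym {X = X} {Y} conf , comodular-sym O {X} {Y} conf com ,
    - Z , symmetric cZ , neg-zero {X = Z} Ze , between-sym {X = X} {Y} {Z} betw ,
    trans (lookup-neg Z f) (cong ⊝_ Zf)

  module _ (euclid : Euclidean O) where

    -- The directed step itself shows that (O , e , f) is a program: its ends are nonzero at `e`,
    -- and its elimination vanishes at `e` but not at `f`.
    acyclic-⊕ : ¬ Cycle (Link e f ⊕ ⊕) (Link e f ⊕ 𝟎)
    acyclic-⊕ {e} {f} C
      with i , Xe , Ye , conf , com@(cX , cY , _) , Z , cZ , Ze , betw , Zf ← Cycle.directed C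
      with e ≟ f
    ... | yes refl with () ← trans (sym Ze) Zf
    ... | no e≢f = euclid P record
      { vertex   = vertex
      ; closed   = closed
      ; distinct = distinct
      ; step     = λ i → Sum.map oriented oriented (step i)
      ; directed = proj₁ directed , oriented (proj₂ directed)
      }
      where
      open Cycle C
      P : Program O
      P = program e f e≢f (cocircuit⇒nonloop O cX λ q → 1≢0 (trans (sym Xe) q)) λ coloop →
            1≢0 (trans (sym Zf) (coloop-between O {Z = Z} cX cY betw (λ q → 1≢0 (trans (sym Xe) q))
              (λ q → 1≢0 (trans (sym Ye) q)) e≢f coloop))
        where
        1≢0 : ⊕ ≢ 𝟎
        1≢0 ()
      oriented : ∀ {s X Y} → Link e f ⊕ s X Y → Adjacent P X Y × Oriented P s X Y
      oriented {X = X} {Y} (Xe , Ye , conf , com@(cX , cY , _) , Z , cZ , Ze , betw , Zf) =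
        ((cX , Xe) , (cY , Ye) , conf , com) ,
        Z , (cZ , Ze , between⇒eliminates {X = X} {Y} {Z} conf betw) , Zf

    neg-injective : Injective _≡_ _≡_ (-_ {n})
    neg-injective {X} {Y} p = trans (sym (neg-involutive X)) (trans (cong -_ p) (neg-involutive Y))

    -- Negation flips the side of `e` and the orientation, reversal only the orientation; this
    -- reduces all cases to `⊕` and `⊕`.
    acyclic : ∀ a t → a ≢ 𝟎 → t ≢ 𝟎 → ¬ Cycle (Link e f a t) (Link e f a 𝟎)
    acyclic ⊕ ⊕ _ _ C = acyclic-⊕ C
    acyclic ⊕ ⊖ _ _ C = acyclic-⊕ (reverse link-sym link-sym C)
    acyclic ⊖ ⊖ _ _ C = acyclic-⊕ (map-cycle -_ neg-injective link-neg link-neg C)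
    acyclic ⊖ ⊕ _ _ C =
      acyclic-⊕ (reverse link-sym link-sym (map-cycle -_ neg-injective link-neg link-neg C))
    acyclic 𝟎 _ a _ _ = a refl
    acyclic _ 𝟎 _ t _ = t refl

-- Steps of the program (O ∪ p , p , f)

level : Sign₀ → ℕ
level ⊖ = 0
level 𝟎 = 1
level ⊕ = 2

level-injective : level s ≡ level t → s ≡ t
level-injective {⊕} {⊕} _ = refl
level-injective {⊖} {⊖} _ = refl
level-injective {𝟎} {𝟎} _ = refl

-- Conformality forbids a jump from `⊕` to `⊖`. If one end is `𝟎` at `f`, `Between` gives the other
-- end by the sign of `D`, which is not `⊖`.
level-monotone : Conformal X Y → Between X Y D → lookup D f ≡ ⊕ ⊎ lookup D f ≡ 𝟎 →
                 level (lookup X f) ≤ level (lookup Y f)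
level-monotone {X = X} {Y} {f = f} conf betw Df =
  go (conformal-agree {X = X} {Y} conf f) (proj₁ (betw f)) (proj₂ (betw f)) Df
  where
  go : ∀ {x y d} → (x ≢ 𝟎 → y ≢ 𝟎 → x ≡ y) → (x ≡ 𝟎 → d ≡ y) → (y ≡ 𝟎 → d ≡ ⊝ x) →
       d ≡ ⊕ ⊎ d ≡ 𝟎 → level x ≤ level y
  go {⊖}         _ _ _ _ = z≤n
  go {𝟎} {⊕}     _ _ _ _ = s≤s z≤n
  go {𝟎} {𝟎}     _ _ _ _ = ℕ.≤-refl
  go {𝟎} {⊖}     _ l _ d with l refl
  go {𝟎} {⊖}     _ l _ (inj₁ ()) | refl
  go {𝟎} {⊖}     _ l _ (inj₂ ()) | refl
  go {⊕} {⊕}     _ _ _ _ = ℕ.≤-refl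
  go {⊕} {⊖}     c _ _ _ with () ← c (λ ()) (λ ())
  go {⊕} {𝟎}     _ _ r d with r refl
  go {⊕} {𝟎}     _ _ r (inj₁ ()) | refl
  go {⊕} {𝟎}     _ _ r (inj₂ ()) | refl

module _ (O : OrientedMatroid n) (σ : SignVector n → Sign₀) (O∪p : OrientedMatroid (suc n))
         (ext : IsExtension O σ O∪p) (f : Fin n) where
  open OrientedMatroid O
  private module P = OrientedMatroid O∪p

  -- A step of the cycle with the coordinate of p dropped; `Z′-sign` covers directed and undirected
  -- steps alike.
  record Step (X Y : SignVector n) : Set where
    field
      σX≡⊕      : σ X ≡ ⊕
      σY≡⊕      : σ Y ≡ ⊕
      conformal : Conformal X Y
      comodular : Comodular O X Y
      -- The result of eliminating p is 𝟎 ∷ Z′.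
      {Z′}      : SignVector n
      cocircuit : P.Cocircuit (𝟎 ∷ Z′)
      between   : Between X Y Z′
      Z′-sign    : lookup Z′ f ≡ ⊕ ⊎ lookup Z′ f ≡ 𝟎

    cX : Cocircuit X
    cX = proj₁ comodular
    cY : Cocircuit Y
    cY = proj₁ (proj₂ comodular)
    line : Line O X Y
    line = comodular⇒line O comodular
    onX : OnLine O X Y X
    onX = cX , λ _ p _ → p
    onY : OnLine O X Y Y
    onY = cY , λ _ _ p → p

    Z′-positive : lookup Z′ f ≢ 𝟎 → lookup Z′ f ≡ ⊕
    Z′-positive ne = [ (λ p → p) , (λ q → ⊥-elim (ne q)) ]′ Z′-sign

    nonzero-at-f : lookup Z′ f ≡ ⊕ → lookup X f ≡ 𝟎 → lookup Y f ≢ 𝟎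
    nonzero-at-f p q r with () ← trans (sym p) (between-vanishes {X = X} {Y} {Z′} between f q r)

    -- On this line `σ` is read off at `e` first; `ρ` stands for the later terms and decides only
    -- where `e` vanishes.
    module _ (a : Sign) (ρ : SignVector n → Sign₀) (e : Fin n)
             (lex : ∀ {U} → OnLine O X Y U → σ U ≡ a · lookup U e ▹ ρ U) where

      near : ¬ (lookup X e ≡ 𝟎 × lookup Y e ≡ 𝟎) → ∀ {Z h} → OnLine O X Y Z → lookup Z e ≡ 𝟎 →
             lookup Z h ≢ 𝟎 → lookup Z′ h ≡ lookup Z h →
             (σ Z ≡ 𝟎 × Z′ ≡ Z) ⊎
             ∃[ W ] OnLine O X Y W × σ Z ≢ 𝟎 × a · lookup W e ≡ ⊝ σ Z × Z′ ≡ Z ⊚ W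
      near e∉ onZ = locate O σ O∪p ext {X = X} {Y} {a = a} ρ line e∉ lex cocircuit
        (between-vanishes {X = X} {Y} {Z′} between) onZ

      lead : ∀ {U} → OnLine O X Y U → lookup U e ≢ 𝟎 → σ U ≡ ⊕ → a · lookup U e ≡ ⊕
      lead onU Ue σU = trans (sym (▹-nonzero (λ q → Ue (·-zero⁻ a q)))) (trans (sym (lex onU)) σU)

      -- `Z′` is `Z` or `Z ⊚ W`, so it inherits every nonzero entry of `Z`.
      near-sign : ¬ (lookup X e ≡ 𝟎 × lookup Y e ≡ 𝟎) → ∀ {Z h} → OnLine O X Y Z → lookup Z e ≡ 𝟎 →
                  lookup Z h ≢ 𝟎 → lookup Z′ h ≡ lookup Z h → lookup Z f ≢ 𝟎 → lookup Z f ≡ ⊕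
      near-sign e∉ {Z} onZ Ze Zh Dh Zf = trans (sym Df) (Z′-positive λ q → Zf (trans (sym Df) q))
        where
        Df : lookup Z′ f ≡ lookup Z f
        Df with near e∉ onZ Ze Zh Dh
        ... | inj₁ (_ , D≡) = cong (λ V → lookup V f) D≡
        ... | inj₂ (W , _ , _ , _ , D≡) =
          trans (cong (λ V → lookup V f) D≡) (trans (lookup-⊚ Z W f) (▹-nonzero Zf))

      -- Here `Y` is itself the cocircuit of `e` on the line, and `Z′` agrees with it where only `X`
      -- vanishes.
      leaves-e : lookup X e ≢ 𝟎 → lookup Y e ≡ 𝟎 → lookup Y f ≢ 𝟎 → lookup Y f ≡ ⊕
      leaves-e Xe Ye Yf
        with h , Yh , Xh ← escape O cY cX (comodular⇒≢± O comodular ∘ ≡±-sym) =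
        near-sign (Xe ∘ proj₁) onY Ye Yh (proj₁ (between h) Xh) Yf

      -- Now `- X` is the cocircuit of `e` that `Z′` is close to, whence the opposite sign.
      enters-e : lookup X e ≡ 𝟎 → lookup Y e ≢ 𝟎 → lookup X f ≢ 𝟎 → lookup X f ≡ ⊖
      enters-e Xe Ye Xf
        with h , Xh , Yh ← escape O cX cY (comodular⇒≢± O comodular) =
        trans (sym (⊝-involutive _)) (cong ⊝_ (trans (sym (lookup-neg X f))
          (near-sign (Ye ∘ proj₂) (onLine-neg O {X} {Y} onX) (neg-zero {X = X} Xe) (neg-nonzero Xh)
                     (trans (proj₂ (between h) Yh) (sym (lookup-neg X h))) (neg-nonzero Xf))))
        where
        neg-nonzero : ∀ {h} → lookup X h ≢ 𝟎 → lookup (- X) h ≢ 𝟎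
        neg-nonzero {h} p q = p (⊝-zero⁻ (trans (sym (lookup-neg X h)) q))

      module _ (Xe : lookup X e ≢ 𝟎) (Ye : lookup Y e ≢ 𝟎) where
        private
          elim : ∃[ Z ] Cocircuit Z × lookup Z e ≡ 𝟎 × Between X Y Z
          elim = eliminate O conformal comodular Xe Ye

        Zᵉ : SignVector n
        Zᵉ = proj₁ elim
        cZᵉ : Cocircuit Zᵉ
        cZᵉ = proj₁ (proj₂ elim)
        Ze : lookup Zᵉ e ≡ 𝟎
        Ze = proj₁ (proj₂ (proj₂ elim))
        betweenZ : Between X Y Zᵉ
        betweenZ = proj₂ (proj₂ (proj₂ elim))
        onZ : OnLine O X Y Zᵉ
        onZ = cZᵉ , between-vanishes {X = X} {Y} {Zᵉ} betweenZ

        private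
          located : (σ Zᵉ ≡ 𝟎 × Z′ ≡ Zᵉ) ⊎
                    ∃[ W ] OnLine O X Y W × σ Zᵉ ≢ 𝟎 × a · lookup W e ≡ ⊝ σ Zᵉ × Z′ ≡ Zᵉ ⊚ W
          -- Where only `Y` vanishes, `Z′` and `Zᵉ` have the same nonzero entry, the negative of
          -- that of `X`.
          located with h , Xh , Yh ← escape O cX cY (comodular⇒≢± O comodular) =
            near (Xe ∘ proj₁) onZ Ze (λ q → Xh (⊝-zero⁻ (trans (sym (proj₂ (betweenZ h) Yh)) q)))
                 (trans (proj₂ (between h) Yh) (sym (proj₂ (betweenZ h) Yh)))

        Z-sign : lookup Zᵉ f ≢ 𝟎 → lookup Zᵉ f ≡ ⊕
        Z-sign with h , Xh , Yh ← escape O cX cY (comodular⇒≢± O comodular) =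
          near-sign (Xe ∘ proj₁) onZ Ze (λ q → Xh (⊝-zero⁻ (trans (sym (proj₂ (betweenZ h) Yh)) q)))
                 (trans (proj₂ (between h) Yh) (sym (proj₂ (betweenZ h) Yh)))

        -- If `σ` vanished at `Zᵉ`, then `Z′` would be `Zᵉ`.
        Z-tie : lookup Zᵉ f ≡ 𝟎 → lookup Z′ f ≡ ⊕ → σ Zᵉ ≢ 𝟎
        Z-tie Zf Df σZ with located
        ... | inj₂ (_ , _ , ne , _)  = ne σZ
        ... | inj₁ (_ , D≡) with () ← trans (sym Zf) (trans (sym (cong (λ V → lookup V f) D≡)) Df)

        -- As `Zᵉ` vanishes at `f`, `Z′` has the sign of `W` there. On the line `f` is parallel or
        -- antiparallel to `e`, so `W` and `Y` compare at `f` as they do at `e`: they agree if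
        -- `σ Zᵉ` is `⊖` and are opposite if it is `⊕`. The sign of `Z′` at `f` can only be `⊕`.
        σZ-sign : lookup Zᵉ f ≡ 𝟎 → lookup Y f ≢ 𝟎 → σ Zᵉ ≢ 𝟎 → σ Zᵉ ≡ ⊝ lookup Y f
        σZ-sign Zf Yf σZ with located
        ... | inj₁ (σZ≡𝟎 , _) = ⊥-elim (σZ σZ≡𝟎)
        ... | inj₂ (W , onW , _ , We , D≡) = go (σ Zᵉ) refl
          where
          same : ∀ {V} → OnLine O X Y V → a · lookup V e ≡ ⊕ → lookup Y f ≡ lookup V f
          same onV Ve = parallel-signs O {X} {Y} line onZ onY onV Ze Zf (Yf ∘ proj₂) (Ye ∘ proj₂) Ye
                          (·-injective a (trans (lead onY Ye σY≡⊕) (sym Ve)))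
          Wf≡Df : lookup W f ≡ lookup Z′ f
          Wf≡Df = sym (trans (cong (λ V → lookup V f) D≡) (trans (lookup-⊚ Zᵉ W f) (cong (_▹ lookup W f) Zf)))
          go : ∀ τ → σ Zᵉ ≡ τ → σ Zᵉ ≡ ⊝ lookup Y f
          go 𝟎 eq = ⊥-elim (σZ eq)
          go ⊖ eq = trans eq (cong ⊝_ (sym (trans Y≡D (Z′-positive λ q → Yf (trans Y≡D q)))))
            where
            Y≡D : lookup Y f ≡ lookup Z′ f
            Y≡D = trans (same onW (trans We (cong ⊝_ eq))) Wf≡Df
          go ⊕ eq = trans eq (sym (trans -Y≡D (Z′-positive λ q → Yf (⊝-zero⁻ (trans -Y≡D q)))))
            where
            -Y≡D : ⊝ lookup Y f ≡ lookup Z′ f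
            -Y≡D = trans (cong ⊝_ (trans
                (same (onLine-neg O {X} {Y} onW) (trans (cong (a ·_) (lookup-neg W e))
                  (trans (·-⊝ a _) (cong ⊝_ (trans We (cong ⊝_ eq))))))
                (lookup-neg W f)))
              (trans (⊝-involutive _) Wf≡Df)

-- Excluding closed walks with a directed step

module _ (O : OrientedMatroid n) (euclid : Euclidean O) (σ : SignVector n → Sign₀)
         (O∪p : OrientedMatroid (suc n)) (ext : IsExtension O σ O∪p) (f : Fin n) where
  open OrientedMatroid O
  open Step

  module _ {m : ℕ} (x : Fin (suc m) → SignVector n) (closed : x (fromℕ m) ≡ x zero)
           (distinct : Injective _≡_ _≡_ (x ∘ inject₁))
           (steps : ∀ i → Step O σ O∪p ext f (x (inject₁ i)) (x (suc i)))
           (i₀ : Fin m) (positive : lookup (Z′ (steps i₀)) f ≡ ⊕) where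

    Lex : Sign → (SignVector n → Sign₀) → Fin n → Set
    Lex a ρ e = ∀ i {U} → OnLine O (x (inject₁ i)) (x (suc i)) U → σ U ≡ a · lookup U e ▹ ρ U

    -- The level never falls along a step, and the walk is closed.
    f-constant : ∀ j k → lookup (x j) f ≡ lookup (x k) f
    f-constant j k = level-injective (ℕ.≤-antisym (below j k) (below k j))
      where
      below : ∀ j k → level (lookup (x j) f) ≤ level (lookup (x k) f)
      below j k = around (λ k → level (lookup (x j) f) ≤ level (lookup (x k) f))
        (λ i le → ℕ.≤-trans le
          (level-monotone {X = x (inject₁ i)} {x (suc i)} {D = Z′ (steps i)}
            (conformal (steps i)) (between (steps i)) (Z′-sign (steps i))))
        (subst (λ X → level (lookup (x j) f) ≤ level (lookup X f)) closed)
        {j} {k} ℕ.≤-refl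

    f-nonzero : ∀ j → lookup (x j) f ≢ 𝟎
    f-nonzero j p = nonzero-at-f (steps i₀) positive (trans (f-constant _ j) p) (trans (f-constant _ j) p)

    -- If `f` is `⊕` on the cycle, no step moves off the hyperplane of `e`, so one vertex on it
    -- would put all vertices on it. If `f` is `⊖`, no step moves onto it, so one vertex off it
    -- keeps all of them off.
    lines-through-e : ∀ {a ρ e} → Lex a ρ e → ¬ (∀ j → lookup (x j) e ≡ 𝟎) → ∀ j → lookup (x j) e ≢ 𝟎
    lines-through-e {a} {ρ} {e} lex not-all j with lookup (x zero) f in sf
    ... | 𝟎 = ⊥-elim (f-nonzero zero sf)
    ... | ⊕ = λ q → not-all λ k →
      around (λ j → lookup (x j) e ≡ 𝟎)
        (λ i Xe → decidable-stable (_ ≟₀ _) λ Ye →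
          ⊕≢⊖ (trans (sym sf) (trans (f-constant zero _)
            (enters-e (steps i) a ρ e (lex i) Xe Ye (f-nonzero _)))))
        (subst (λ X → lookup X e ≡ 𝟎) closed) {j} {k} q
      where
      ⊕≢⊖ : ⊕ ≢ ⊖
      ⊕≢⊖ ()
    ... | ⊖ with k , Xe ← ¬∀⟶∃¬ _ _ (λ j → lookup (x j) e ≟₀ 𝟎) not-all =
      around (λ j → lookup (x j) e ≢ 𝟎)
        (λ i Xe Ye → ⊖≢⊕ (trans (sym sf) (trans (f-constant zero _)
            (leaves-e (steps i) a ρ e (lex i) Xe Ye (f-nonzero _)))))
        (subst (λ X → lookup X e ≢ 𝟎) closed) {k} {j} Xe
      where
      ⊖≢⊕ : ⊖ ≢ ⊕
      ⊖≢⊕ ()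

    module _ (a : Sign) (ρ : SignVector n → Sign₀) (e : Fin n)
             (lex : Lex a ρ e) (nz : ∀ j → lookup (x j) e ≢ 𝟎) where

      pivot : Fin m → SignVector n
      pivot i = Zᵉ (steps i) a ρ e (lex i) (nz (inject₁ i)) (nz (suc i))

      pivot-at-e : ∀ i → lookup (pivot i) e ≡ 𝟎
      pivot-at-e i = Ze (steps i) a ρ e (lex i) (nz (inject₁ i)) (nz (suc i))

      -- The side is `a · ⊕` because `σ` is `⊕` at every vertex and equals `a` times the entry at
      -- `e`.
      link : ∀ i {g s} → lookup (pivot i) g ≡ s → Link O e g (a · ⊕) s (x (inject₁ i)) (x (suc i))
      link i Zg =
        e-sign (lead S a ρ e (lex i) (onX S) (nz _) (σX≡⊕ S)) ,
        e-sign (lead S a ρ e (lex i) (onY S) (nz _) (σY≡⊕ S)) ,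
        conformal S , comodular S , pivot i , cZᵉ S a ρ e (lex i) (nz _) (nz _) , pivot-at-e i ,
        betweenZ S a ρ e (lex i) (nz _) (nz _) , Zg
        where
        S = steps i
        e-sign : ∀ {s} → a · s ≡ ⊕ → s ≡ a · ⊕
        e-sign p = trans (sym (·-involutive a _)) (cong (a ·_) p)

      -- A nonzero entry at `g` would turn the walk into a directed cycle of (O , e , g) or,
      -- depending on the signs, of its negative or reverse.
      one-signed⇒zero : ∀ g t → t ≢ 𝟎 → (∀ i → lookup (pivot i) g ≢ 𝟎 → lookup (pivot i) g ≡ t) →
                        ∀ i → lookup (pivot i) g ≡ 𝟎
      one-signed⇒zero g t t≢𝟎 sign i = decidable-stable (_ ≟₀ _) λ Zg →
        acyclic O euclid (a · ⊕) t (a⊕ a) t≢𝟎 record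
          { vertex   = x
          ; closed   = closed
          ; distinct = distinct
          ; step     = λ j → links j (lookup (pivot j) g ≟₀ 𝟎)
          ; directed = i , link i (sign i Zg)
          }
        where
        a⊕ : ∀ a → a · ⊕ ≢ 𝟎
        a⊕ Sign.+ ()
        a⊕ Sign.- ()
        links : ∀ j → Dec (lookup (pivot j) g ≡ 𝟎) →
                Link O e g (a · ⊕) t (x (inject₁ j)) (x (suc j)) ⊎
                Link O e g (a · ⊕) 𝟎 (x (inject₁ j)) (x (suc j))
        links j (yes p) = inj₂ (link j p)
        links j (no p)  = inj₁ (link j (sign j p))

      pivot-at-f : ∀ i → lookup (pivot i) f ≡ 𝟎
      pivot-at-f = one-signed⇒zero f ⊕ (λ ()) λ i → Z-sign (steps i) a ρ e (lex i) (nz _) (nz _)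

      τ : Sign₀
      τ = ⊝ lookup (x zero) f

      σ-sign : ∀ i → σ (pivot i) ≢ 𝟎 → σ (pivot i) ≡ τ
      σ-sign i ne = trans (σZ-sign (steps i) a ρ e (lex i) (nz _) (nz _) (pivot-at-f i) (f-nonzero _) ne)
                          (cong ⊝_ (f-constant (suc i) zero))

      σ-zero : ∀ {k} (J : Vec (Fin n) k) (α : Vec Sign k) →
               (∀ i → σ (pivot i) ≡ lexicographic J α (pivot i)) → ∀ i → σ (pivot i) ≡ 𝟎
      σ-zero []      []      lexJ i = lexJ i
      σ-zero (g ∷ J) (b ∷ α) lexJ = σ-zero J α λ i →
        trans (lexJ i) (trans (cong (λ t → b · t ▹ lexicographic J α (pivot i)) (Zg i)) (·-𝟎-▹ b))
        where
        Zg : ∀ i → lookup (pivot i) g ≡ 𝟎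
        -- Multiplication by `b` is an involution, so `b · τ` is the only entry at `g` that yields
        -- `τ`.
        Zg = one-signed⇒zero g (b · τ) (λ q → f-nonzero zero (⊝-zero⁻ (·-zero⁻ b q))) λ i ne →
          let bZ≢𝟎 = λ q → ne (·-zero⁻ b q)
              σZ≡ = trans (lexJ i) (▹-nonzero bZ≢𝟎)
          in trans (sym (·-involutive b _))
               (cong (b ·_) (trans (sym σZ≡) (σ-sign i λ q → bZ≢𝟎 (trans (sym σZ≡) q))))

    -- Elements that vanish at all vertices vanish on all lines of the cycle and are dropped until
    -- some `e` leads. Then `Z-tie` and `σ-zero` contradict each other at the directed step `i₀`.
    no-cycle : ∀ {k} (J : Vec (Fin n) k) (α : Vec Sign k) →
      (∀ i {U} → OnLine O (x (inject₁ i)) (x (suc i)) U → σ U ≡ lexicographic J α U) → ⊥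
    no-cycle [] [] lex with () ← trans (sym (σX≡⊕ (steps i₀))) (lex i₀ (onX (steps i₀)))
    no-cycle (e ∷ J) (a ∷ α) lex with all? (λ j → lookup (x j) e ≟₀ 𝟎)
    ... | yes p = no-cycle J α λ i {U} onU@(_ , zU) →
      trans (lex i onU) (trans (cong (λ t → a · t ▹ lexicographic J α U) (zU e (p _) (p _))) (·-𝟎-▹ a))
    ... | no ¬p =
      Z-tie (steps i₀) a ρ e (lex i₀) (nz _) (nz _) (pivot-at-f a ρ e lex nz i₀) positive
        (σ-zero a ρ e lex nz J α σ-pivot i₀)
      where
      ρ = lexicographic J α
      nz : ∀ j → lookup (x j) e ≢ 𝟎
      nz = lines-through-e {a} {ρ} lex ¬p
      σ-pivot : ∀ i → σ (pivot a ρ e lex nz i) ≡ ρ (pivot a ρ e lex nz i)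
      σ-pivot i = trans (lex i (onZ (steps i) a ρ e (lex i) (nz _) (nz _)))
        (trans (cong (λ t → a · t ▹ ρ (pivot a ρ e lex nz i)) (pivot-at-e a ρ e lex nz i)) (·-𝟎-▹ a))

-- From directed cycles of (O ∪ p , p , f) to walks in O

theorem1p1 : ∀ (n : ℕ) (O : OrientedMatroid n) → Euclidean O →
    ∀ (k : ℕ) (I : Vec (Fin n) k) → Unique I → (α : Vec Sign k) →
    (O∪p : OrientedMatroid (suc n)) → IsLexicographicExtension O I α O∪p →
    (p-nonloop : ¬ IsLoop O∪p zero) →
    (f : Fin n) (f-noncoloop : ¬ IsColoop O∪p (suc f)) →
    EuclideanProgram (program {O = O∪p} zero (suc f) 0≢1+n p-nonloop f-noncoloop)
theorem1p1 n O euclid k I _ α O∪p ext p-nonloop f f-noncoloop C =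
  no-cycle O euclid σ O∪p ext f (Vec.tail ∘ vertex) (cong Vec.tail closed)
    -- All vertices are `⊕` at p, so they stay distinct without that coordinate.
    (λ {i} {j} p → distinct (vec-≡ (proj₂ (source i)) (proj₂ (source j)) p))
    steps i₀ positive I α (λ _ _ → refl)
  where
  open DirectedCycle C
  σ = lexicographic I α
  P = program {O = O∪p} zero (suc f) 0≢1+n p-nonloop f-noncoloop
  i₀ = proj₁ directed

  vec-≡ : ∀ {V W : SignVector (suc n)} → lookup V zero ≡ ⊕ → lookup W zero ≡ ⊕ →
          Vec.tail V ≡ Vec.tail W → V ≡ W
  vec-≡ {v ∷ X} {w ∷ Y} refl refl refl = refl

  source : ∀ i → Vertex P (vertex (inject₁ i))
  source i = [ (λ q → proj₁ (proj₁ q)) , (λ q → proj₁ (proj₁ q)) ]′ (step i)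

  Steps : Sign₀ → SignVector (suc n) → SignVector (suc n) → Set
  Steps s V W = ∃[ S ] lookup (Step.Z′ {O = O} {σ} {O∪p} {ext} {f} {Vec.tail V} {Vec.tail W} S) f ≡ s

  to-step : ∀ {s V W} → s ≡ ⊕ ⊎ s ≡ 𝟎 → Adjacent P V W × Oriented P s V W → Steps s V W
  to-step {s} {_ ∷ X} {_ ∷ Y} s-sign
    (((cV , refl) , (cW , refl) , conf , com) , (z ∷ D) , (cD , refl , elim) , Df) = record
    { σX≡⊕      = proj₂ (old-cocircuit O σ O∪p ext cV λ ())
    ; σY≡⊕      = proj₂ (old-cocircuit O σ O∪p ext cW λ ())
    ; conformal = conf′
    ; comodular = comodular⁻ O σ O∪p ext conf′ com
    ; cocircuit = cD
    ; between   = eliminates⇒between {X = X} {Y} {D} λ h h∉ → elim (suc h) λ { (there q) → h∉ q }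
    ; Z′-sign   = subst (λ s → s ≡ ⊕ ⊎ s ≡ 𝟎) (sym Df) s-sign
    } , Df
    where
    conf′ : Conformal X Y
    conf′ (h , q) = conf (suc h , there q)

  positive-step = to-step (inj₁ refl) (proj₂ directed)

  -- At `i₀` the step comes from `directed`, since `step i₀` need not carry the elimination that is
  -- `⊕` at `f`.
  choose : ∀ i → Dec (i₀ ≡ i) → Step O σ O∪p ext f (Vec.tail (vertex (inject₁ i))) (Vec.tail (vertex (suc i)))
  choose i (yes refl) = proj₁ positive-step
  choose i (no _)     = [ proj₁ ∘ to-step (inj₁ refl) , proj₁ ∘ to-step (inj₂ refl) ]′ (step i)

  steps : ∀ i → Step O σ O∪p ext f (Vec.tail (vertex (inject₁ i))) (Vec.tail (vertex (suc i)))
  steps i = choose i (i₀ ≟ i)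

  positive : lookup (Step.Z′ (steps i₀)) f ≡ ⊕
  positive with i₀ ≟ i₀
  ... | yes refl = proj₂ positive-step
  ... | no ne    = ⊥-elim (ne refl)
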